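{- Let $a,b,c\in\mathbb{Q}$ with $abc\neq0$, $2ac-b^2\neq 0$ and $4ac-b^2\neq 0$. Then the elliptic curve \[\mathcal{E}_2:\ Y^2=X^3-3a^4c^4X+a^4c^4(2a^2c^2-4ab^2c+b^4)\] over $\mathbb{Q}$ has positive rank. -}

module Defs where

open import Data.Nat using (ℕ; zero; suc)
open import Data.Rational using (ℚ; 0ℚ; 1ℚ; _+_; _-_; _*_; _÷_; -_; ≢-nonZero)
open import Data.Rational.Properties using (_≟_)
open import Data.Product using (Σ; ∃; _×_; _,_)
open import Relation.Nullary using (yes; no; ¬_)
open import Relation.Binary.PropositionalEquality using (_≡_; _≢_)

-- Rational points of a short Weierstrass curve  Y² = X³ + A X + B  over ℚ:
-- affine points plus the point at infinity O.
data Pt : Set where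
  O   : Pt
  aff : ℚ → ℚ → Pt

2ℚ 3ℚ : ℚ
2ℚ = 1ℚ + 1ℚ
3ℚ = 2ℚ + 1ℚ

OnCurve : ℚ → ℚ → ℚ → ℚ → Set
OnCurve A B x y = y * y ≡ x * x * x + A * x + B

-- Chord-and-tangent group law on Y² = X³ + A X + B (the formulas only involve A).
-- If x₂ - x₁ ≠ 0: chord slope (y₂ - y₁)/(x₂ - x₁).
-- If x₁ = x₂: either y₁ + y₂ = 0 (then P₂ = -P₁ and the sum is O), or, for points
-- on the curve, y₁ = y₂ ≠ 0 and the tangent slope (3x₁² + A)/(2y₁) = (3x₁² + A)/(y₁ + y₂).
third : ℚ → ℚ → ℚ → ℚ → Pt
third l x₁ y₁ x₂ = aff (l * l - x₁ - x₂) (l * (x₁ - (l * l - x₁ - x₂)) - y₁)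

add : ℚ → Pt → Pt → Pt
add A O Q = Q
add A (aff x₁ y₁) O = aff x₁ y₁
add A (aff x₁ y₁) (aff x₂ y₂) with (x₂ - x₁) ≟ 0ℚ
... | no d≢0 = third (_÷_ (y₂ - y₁) (x₂ - x₁) {{≢-nonZero d≢0}}) x₁ y₁ x₂
... | yes _ with (y₁ + y₂) ≟ 0ℚ
...   | yes _  = O
...   | no s≢0 = third (_÷_ (3ℚ * x₁ * x₁ + A) (y₁ + y₂) {{≢-nonZero s≢0}}) x₁ y₁ x₂

mul : ℚ → ℕ → Pt → Pt
mul A zero    P = O
mul A (suc n) P = add A P (mul A n P)

PositiveRank : ℚ → ℚ → Set
PositiveRank A B =
  ∃ λ x → ∃ λ y → OnCurve A B x y × ((n : ℕ) → mul A (suc n) (aff x y) ≢ O)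

A₂ : ℚ → ℚ → ℚ → ℚ
A₂ a b c = - (3ℚ * (a * a * a * a) * (c * c * c * c))

B₂ : ℚ → ℚ → ℚ → ℚ
B₂ a b c = (a * a * a * a) * (c * c * c * c)
           * (2ℚ * (a * a) * (c * c) - 4ℚ * a * (b * b) * c + b * b * b * b)
  where
    4ℚ : ℚ
    4ℚ = 2ℚ + 2ℚ

{-# OPTIONS --safe #-}
-- With u = ac and su = b² - 2ac ≠ 0, the curve is a rescaling of Y² = X³ - 3X + (s² - 2), which contains P = (-1, s).
-- Depending on the 2-adic valuation of s, one of the points 4P, 3P, 5P has its x-coordinate so large 2-adically that,
-- scaled by it, the curve reduces to the cusp Y² = X³ modulo 2 with the point Q in question regular.
-- The multiples of such a Q stay regular. Let nQ = O with n > 0 minimal. If n = 2m, then mQ = -mQ has Y = 0, which is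
-- impossible at a regular point. If n = 2m + 1, then Q = -2(mQ), but doubling a regular point produces an
-- x-coordinate with an additional factor 1/4, so a point with the valuation of Q is not such a double.
module Submission where

open import Defs
open import Data.Empty using (⊥; ⊥-elim)
open import Data.Integer as ℤ using (ℤ; +_; -[1+_])
import Data.Integer.DivMod as ℤD
import Data.Integer.Properties as ℤP
open import Data.Nat as ℕ using (ℕ; zero; suc; s≤s; z≤n)
import Data.Nat.Coprimality as Coprimality
open import Data.Nat.Divisibility using (_∣_; divides)
open import Data.Nat.Induction using (<-rec)
import Data.Nat.Properties as ℕP
open import Data.Product using (∃; _×_; _,_; proj₁; proj₂)
open import Data.Rational
  using (ℚ; mkℚ; 0ℚ; 1ℚ; ½; _+_; _*_; _-_; -_; _/_; 1/_; _÷_; NonZero; ≢-nonZero)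
open import Data.Rational.Properties
import Data.Rational.Unnormalised as ℚᵘ
open import Data.Sum using (_⊎_; inj₁; inj₂)
open import Function using (_∘_)
open import Level using (0ℓ)
open import Relation.Binary.PropositionalEquality
  using (_≡_; _≢_; refl; sym; trans; cong; cong₂; subst; module ≡-Reasoning)
open import Relation.Nullary using (¬_; yes; no; contradiction)
open import Relation.Nullary.Decidable using (dec⇒maybe)
open import Tactic.RingSolver using (solve-∀)
open import Tactic.RingSolver.Core.AlmostCommutativeRing
  using (AlmostCommutativeRing; fromCommutativeRing)

-- Let v be the 2-adic valuation. The abscissa 4s²/9 - 1 of 3P has a pole at 2 exactly when v(s) ≤
-- -2, and the abscissa 81/(4s²) - 4 of 4P exactly when v(s) ≥ 0. At v(s) = -1 both are 2-integral;
-- there the chord from 2P to 3P has a slope of valuation -1, so the abscissa of 5P has valuation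
-- -2. At the chosen point (x, y) the pole makes -3/x² and (s² - 2)/x³ even, which is what reduces
-- the scaled curve to the cusp. The only instance of associativity that enters is -Q + (Q + R) = R.
-- Applied repeatedly it turns (m + k)Q = O into mQ = -(kQ), and it also carries regularity from R
-- to Q + R: subtracting Q from a singular point gives a singular point again.

-- Field arithmetic in ℚ.

ring : AlmostCommutativeRing 0ℓ 0ℓ
ring = fromCommutativeRing +-*-commutativeRing λ x → dec⇒maybe (0ℚ ≟ x)

inverse : ∀ {x} → x ≢ 0ℚ → ∃ λ y → y * x ≡ 1ℚ
inverse {x} x≢0 = 1/ x , *-inverseˡ x
  where instance x-nonZero = ≢-nonZero x≢0

*-cancelˡ : ∀ x {y z} → x ≢ 0ℚ → x * y ≡ x * z → y ≡ z
*-cancelˡ x {y} {z} x≢0 xy≡xz = begin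
  y              ≡⟨ *-identityˡ y ⟨
  1ℚ * y         ≡⟨ cong (_* y) ix≡1 ⟨
  i * x * y      ≡⟨ *-assoc i x y ⟩
  i * (x * y)    ≡⟨ cong (i *_) xy≡xz ⟩
  i * (x * z)    ≡⟨ *-assoc i x z ⟨
  i * x * z      ≡⟨ cong (_* z) ix≡1 ⟩
  1ℚ * z         ≡⟨ *-identityˡ z ⟩
  z              ∎
  where
  open ≡-Reasoning
  i = proj₁ (inverse x≢0)
  ix≡1 = proj₂ (inverse x≢0)

*-≢0 : ∀ {x y} → x ≢ 0ℚ → y ≢ 0ℚ → x * y ≢ 0ℚ
*-≢0 {x} x≢0 y≢0 xy≡0 = y≢0 (*-cancelˡ x x≢0 (trans xy≡0 (sym (*-zeroʳ x))))

x-y≡0⇒x≡y : ∀ {x y} → x - y ≡ 0ℚ → x ≡ y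
x-y≡0⇒x≡y {x} {y} x-y≡0 = begin
  x          ≡⟨ split x y ⟩
  x - y + y  ≡⟨ cong (_+ y) x-y≡0 ⟩
  0ℚ + y     ≡⟨ +-identityˡ y ⟩
  y          ∎
  where
  open ≡-Reasoning
  split : ∀ x y → x ≡ x - y + y
  split = solve-∀ ring

x≡y⇒x-y≡0 : ∀ {x y} → x ≡ y → x - y ≡ 0ℚ
x≡y⇒x-y≡0 {x} refl = +-inverseʳ x

-- The local ring ℤ₍₂₎

opaque
  -- The denominator 1 is stored literally, so injectivity is matching on `refl`; being opaque, `ι`
  -- is seen elsewhere only through the laws of the next block.
  ι : ℤ → ℚ
  ι n = mkℚ n 0 (Coprimality.sym (Coprimality.1-coprimeTo ℤ.∣ n ∣))

opaque
  unfolding ι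

  /1≡ι : ∀ n → n / 1 ≡ ι n
  /1≡ι n = ↥p/↧p≡p (ι n)

  ι-+ : ∀ m n → ι m + ι n ≡ ι (m ℤ.+ n)
  ι-+ m n = trans (cong₂ (λ a b → (a ℤ.+ b) / 1) (ℤP.*-identityʳ m) (ℤP.*-identityʳ n)) (/1≡ι _)

  ι-* : ∀ m n → ι m * ι n ≡ ι (m ℤ.* n)
  ι-* m n = /1≡ι _

  ι-neg : ∀ m → - ι m ≡ ι (ℤ.- m)
  ι-neg (+ zero)   = refl
  ι-neg ℤ.+[1+ m ] = refl
  ι-neg -[1+ m ]   = refl

  ι-2 : ι (+ 2) ≡ 2ℚ
  ι-2 = refl

  ι-0 : ι (+ 0) ≡ 0ℚ
  ι-0 = refl

  ι-1 : ι (+ 1) ≡ 1ℚ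
  ι-1 = refl

  ι-injective : ∀ {m n} → ι m ≡ ι n → m ≡ n
  ι-injective refl = refl

  *-denominator : ∀ x → x * ι (ℚ.denominator x) ≡ ι (ℚ.numerator x)
  *-denominator x@(mkℚ n d-1 _) =
    trans (fromℚᵘ-cong {ℚᵘ.mkℚᵘ (n ℤ.* d) (d-1 ℕ.* 1)} {ℚᵘ.mkℚᵘ n 0} (ℚᵘ.*≡* eq)) (/1≡ι n)
    where
    d : ℤ
    d = + suc d-1
    eq : (n ℤ.* d) ℤ.* + 1 ≡ n ℤ.* + suc (d-1 ℕ.* 1)
    eq = trans (ℤP.*-identityʳ (n ℤ.* d)) (cong (λ k → n ℤ.* + suc k) (sym (ℕP.*-identityʳ d-1)))

ι-2* : ∀ n → 2ℚ * ι n ≡ ι (+ 2 ℤ.* n)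
ι-2* n = trans (cong (_* ι n) (sym ι-2)) (ι-* (+ 2) n)

data Parity : ℤ → Set where
  even : ∀ k → Parity (+ 2 ℤ.* k)
  odd  : ∀ k → Parity (+ 1 ℤ.+ + 2 ℤ.* k)

parity : ∀ n → Parity n
parity n with n ℤD.% + 2 | ℤD.n%d<d n (+ 2) | ℤD.a≡a%n+[a/n]*n n (+ 2)
... | 0 | _ | n≡ = subst Parity (sym (trans n≡ (trans (ℤP.+-identityˡ (n ℤD./ + 2 ℤ.* + 2)) (ℤP.*-comm (n ℤD./ + 2) (+ 2))))) (even (n ℤD./ + 2))
... | 1 | _ | n≡ = subst Parity (sym (trans n≡ (cong (λ k → + 1 ℤ.+ k) (ℤP.*-comm (n ℤD./ + 2) (+ 2))))) (odd (n ℤD./ + 2))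
... | suc (suc _) | s≤s (s≤s ()) | _

-- The denominator 1 + 2 ι d is left as a rational so that the closure proofs are ring identities.
record Integral (x : ℚ) : Set where
  constructor integral
  field
    {d m} : ℤ
    cleared : x * (1ℚ + 2ℚ * ι d) ≡ ι m

ι-odd : ∀ d → 1ℚ + 2ℚ * ι d ≡ ι (+ 1 ℤ.+ + 2 ℤ.* d)
ι-odd d = trans (cong₂ _+_ (sym ι-1) (ι-2* d)) (ι-+ (+ 1) (+ 2 ℤ.* d))

private
  -- Chosen so that 1 + 2(d ⊕ e) = (1 + 2d)(1 + 2e): multiplication of odd denominators in the
  -- encoding used by `Integral`.
  ⟦_⊕_⟧ : ℤ → ℤ → ℤ
  ⟦ d ⊕ e ⟧ = (d ℤ.+ e) ℤ.+ + 2 ℤ.* (d ℤ.* e)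

  ι-⊕ : ∀ d e → ι ⟦ d ⊕ e ⟧ ≡ ι d + ι e + 2ℚ * (ι d * ι e)
  ι-⊕ d e = sym (begin
    ι d + ι e + 2ℚ * (ι d * ι e)               ≡⟨ cong₂ (λ a b → a + 2ℚ * b) (ι-+ d e) (ι-* d e) ⟩
    ι (d ℤ.+ e) + 2ℚ * ι (d ℤ.* e)             ≡⟨ cong (λ z → ι (d ℤ.+ e) + z) (ι-2* (d ℤ.* e)) ⟩
    ι (d ℤ.+ e) + ι (+ 2 ℤ.* (d ℤ.* e))        ≡⟨ ι-+ _ _ ⟩
    ι ⟦ d ⊕ e ⟧ ∎)
    where open ≡-Reasoning

integral-ι : ∀ n → Integral (ι n)
integral-ι n = integral {d = + 0} {m = n} (trans (cong (λ z → ι n * (1ℚ + 2ℚ * z)) ι-0) (unit (ι n)))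
  where
  unit : ∀ x → x * (1ℚ + 2ℚ * 0ℚ) ≡ x
  unit = *-identityʳ

integral-1 : Integral 1ℚ
integral-1 = subst Integral ι-1 (integral-ι (+ 1))

integral-2 : Integral 2ℚ
integral-2 = subst Integral ι-2 (integral-ι (+ 2))

integral-neg : ∀ {x} → Integral x → Integral (- x)
integral-neg {x} (integral {d} {m} p) = integral {d = d} {m = ℤ.- m} (begin
  - x * (1ℚ + 2ℚ * ι d)    ≡⟨ neg-distribˡ-* x _ ⟨
  - (x * (1ℚ + 2ℚ * ι d))  ≡⟨ cong -_ p ⟩
  - ι m                    ≡⟨ ι-neg m ⟩
  ι (ℤ.- m)                ∎)
  where open ≡-Reasoning

integral-* : ∀ {x y} → Integral x → Integral y → Integral (x * y)
integral-* {x} {y} (integral {d} {m} p) (integral {e} {n} q) =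
  integral {d = ⟦ d ⊕ e ⟧} {m = m ℤ.* n} (begin
    x * y * (1ℚ + 2ℚ * ι ⟦ d ⊕ e ⟧)                        ≡⟨ cong (λ z → x * y * (1ℚ + 2ℚ * z)) (ι-⊕ d e) ⟩
    x * y * (1ℚ + 2ℚ * (ι d + ι e + 2ℚ * (ι d * ι e)))     ≡⟨ shuffle x y (ι d) (ι e) ⟩
    (x * (1ℚ + 2ℚ * ι d)) * (y * (1ℚ + 2ℚ * ι e))          ≡⟨ cong₂ _*_ p q ⟩
    ι m * ι n                                              ≡⟨ ι-* m n ⟩
    ι (m ℤ.* n)                                            ∎)
  where
  open ≡-Reasoning
  shuffle : ∀ x y a b → x * y * (1ℚ + 2ℚ * (a + b + 2ℚ * (a * b)))
                      ≡ (x * (1ℚ + 2ℚ * a)) * (y * (1ℚ + 2ℚ * b))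
  shuffle = solve-∀ ring

integral-+ : ∀ {x y} → Integral x → Integral y → Integral (x + y)
integral-+ {x} {y} (integral {d} {m} p) (integral {e} {n} q) =
  integral {d = ⟦ d ⊕ e ⟧} {m = m ℤ.* e′ ℤ.+ n ℤ.* d′} (begin
    (x + y) * (1ℚ + 2ℚ * ι ⟦ d ⊕ e ⟧)                      ≡⟨ cong (λ z → (x + y) * (1ℚ + 2ℚ * z)) (ι-⊕ d e) ⟩
    (x + y) * (1ℚ + 2ℚ * (ι d + ι e + 2ℚ * (ι d * ι e)))   ≡⟨ shuffle x y (ι d) (ι e) ⟩
    (x * (1ℚ + 2ℚ * ι d)) * (1ℚ + 2ℚ * ι e) +
      (y * (1ℚ + 2ℚ * ι e)) * (1ℚ + 2ℚ * ι d)              ≡⟨ cong₂ _+_ (cong₂ _*_ p (ι-odd e)) (cong₂ _*_ q (ι-odd d)) ⟩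
    ι m * ι e′ + ι n * ι d′                                ≡⟨ cong₂ _+_ (ι-* m e′) (ι-* n d′) ⟩
    ι (m ℤ.* e′) + ι (n ℤ.* d′)                            ≡⟨ ι-+ _ _ ⟩
    ι (m ℤ.* e′ ℤ.+ n ℤ.* d′)                              ∎)
  where
  open ≡-Reasoning
  d′ = + 1 ℤ.+ + 2 ℤ.* d
  e′ = + 1 ℤ.+ + 2 ℤ.* e
  shuffle : ∀ x y a b → (x + y) * (1ℚ + 2ℚ * (a + b + 2ℚ * (a * b)))
                      ≡ (x * (1ℚ + 2ℚ * a)) * (1ℚ + 2ℚ * b) + (y * (1ℚ + 2ℚ * b)) * (1ℚ + 2ℚ * a)
  shuffle = solve-∀ ring

integral-- : ∀ {x y} → Integral x → Integral y → Integral (x - y)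
integral-- p q = integral-+ p (integral-neg q)

odd≢even : ∀ k → + 1 ≢ + 2 ℤ.* k
odd≢even k eq with ℤ.∣ k ∣ | trans (cong ℤ.∣_∣ eq) (ℤP.abs-* (+ 2) k)
... | suc n | 1≡ = contradiction (trans 1≡ (cong suc (ℕP.+-suc n (n ℕ.+ 0)))) λ ()

-- If x = m/(1 + 2d), clearing the denominator in 1 = 2x gives 1 = 2(m - d) in ℤ. The parity
-- contradictions below are brought to the form 1 = 2θ with θ integral.
½-not-integral : ∀ {x} → Integral x → 1ℚ ≢ 2ℚ * x
½-not-integral {x} (integral {d} {m} p) 1≡2x = odd≢even (m ℤ.- d) (ι-injective (begin
  ι (+ 1)                                  ≡⟨ ι-1 ⟩
  1ℚ                                       ≡⟨ split (ι d) ⟩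
  1ℚ * (1ℚ + 2ℚ * ι d) - 2ℚ * ι d          ≡⟨ cong (λ z → z * (1ℚ + 2ℚ * ι d) - 2ℚ * ι d) 1≡2x ⟩
  2ℚ * x * (1ℚ + 2ℚ * ι d) - 2ℚ * ι d      ≡⟨ gather x (1ℚ + 2ℚ * ι d) (ι d) ⟩
  2ℚ * (x * (1ℚ + 2ℚ * ι d) - ι d)         ≡⟨ cong (λ z → 2ℚ * (z - ι d)) p ⟩
  2ℚ * (ι m - ι d)                         ≡⟨ cong (λ z → 2ℚ * (ι m + z)) (ι-neg d) ⟩
  2ℚ * (ι m + ι (ℤ.- d))                   ≡⟨ cong (2ℚ *_) (ι-+ m (ℤ.- d)) ⟩
  2ℚ * ι (m ℤ.- d)                         ≡⟨ ι-2* (m ℤ.- d) ⟩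
  ι (+ 2 ℤ.* (m ℤ.- d))                    ∎))
  where
  open ≡-Reasoning
  split : ∀ a → 1ℚ ≡ 1ℚ * (1ℚ + 2ℚ * a) - 2ℚ * a
  split = solve-∀ ring
  gather : ∀ x e a → 2ℚ * x * e - 2ℚ * a ≡ 2ℚ * (x * e - a)
  gather = solve-∀ ring

odd-≢0 : ∀ {x} → Integral x → 1ℚ + 2ℚ * x ≢ 0ℚ
odd-≢0 {x} p eq = ½-not-integral (integral-neg p) (trans (split x) (trans (cong (_+ 2ℚ * - x) eq) (+-identityˡ _)))
  where
  split : ∀ x → 1ℚ ≡ 1ℚ + 2ℚ * x + 2ℚ * - x
  split = solve-∀ ring

-- For x = m/(1 + 2d) the inverse of 1 + 2x is (1 + 2d)/(1 + 2(d + m)), again with an odd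
-- denominator.
odd-unit : ∀ {x y} → Integral x → y * (1ℚ + 2ℚ * x) ≡ 1ℚ → Integral y
odd-unit {x} {y} (integral {d} {m} p) yx≡1 =
  integral {d = d ℤ.+ m} {m = + 1 ℤ.+ + 2 ℤ.* d} (begin
    y * (1ℚ + 2ℚ * ι (d ℤ.+ m))                    ≡⟨ cong (λ z → y * (1ℚ + 2ℚ * z)) (ι-+ d m) ⟨
    y * (1ℚ + 2ℚ * (ι d + ι m))                    ≡⟨ cong (λ z → y * (1ℚ + 2ℚ * (ι d + z))) p ⟨
    y * (1ℚ + 2ℚ * (ι d + x * (1ℚ + 2ℚ * ι d)))    ≡⟨ shuffle x y (ι d) ⟩
    y * (1ℚ + 2ℚ * x) * (1ℚ + 2ℚ * ι d)            ≡⟨ cong (_* (1ℚ + 2ℚ * ι d)) yx≡1 ⟩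
    1ℚ * (1ℚ + 2ℚ * ι d)                           ≡⟨ *-identityˡ _ ⟩
    1ℚ + 2ℚ * ι d                                  ≡⟨ ι-odd d ⟩
    ι (+ 1 ℤ.+ + 2 ℤ.* d)                          ∎)
  where
  open ≡-Reasoning
  shuffle : ∀ x y a → y * (1ℚ + 2ℚ * (a + x * (1ℚ + 2ℚ * a))) ≡ y * (1ℚ + 2ℚ * x) * (1ℚ + 2ℚ * a)
  shuffle = solve-∀ ring

-- Reduction modulo 2.

-- The image of x in the projective line over the field of two elements, whose points are 0, 1 and
-- ∞. In the case `pole` the inverse of x is 2y.
data Class₂ (x : ℚ) : Set where
  even : ∀ y → Integral y → x ≡ 2ℚ * y → Class₂ x
  odd  : ∀ y → Integral y → x ≡ 1ℚ + 2ℚ * y → Class₂ x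
  pole : ∀ y → Integral y → 2ℚ * y * x ≡ 1ℚ → Class₂ x

private
  module _ {x i : ℚ} where
    open ≡-Reasoning

    even-quotient : ∀ m l → i * (1ℚ + 2ℚ * l) ≡ 1ℚ → x * (1ℚ + 2ℚ * l) ≡ 2ℚ * m → x ≡ 2ℚ * (m * i)
    even-quotient m l il≡1 eq = begin
      x                              ≡⟨ *-identityʳ x ⟨
      x * 1ℚ                         ≡⟨ cong (x *_) il≡1 ⟨
      x * (i * (1ℚ + 2ℚ * l))        ≡⟨ swap x i (1ℚ + 2ℚ * l) ⟩
      x * (1ℚ + 2ℚ * l) * i          ≡⟨ cong (_* i) eq ⟩
      2ℚ * m * i                     ≡⟨ *-assoc 2ℚ m i ⟩
      2ℚ * (m * i)                   ∎
      where
      swap : ∀ x i e → x * (i * e) ≡ x * e * i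
      swap = solve-∀ ring

    odd-quotient : ∀ m l → i * (1ℚ + 2ℚ * l) ≡ 1ℚ → x * (1ℚ + 2ℚ * l) ≡ 1ℚ + 2ℚ * m →
                   x ≡ 1ℚ + 2ℚ * ((m - l) * i)
    odd-quotient m l il≡1 eq = begin
      x                                          ≡⟨ *-identityʳ x ⟨
      x * 1ℚ                                     ≡⟨ cong (x *_) il≡1 ⟨
      x * (i * (1ℚ + 2ℚ * l))                    ≡⟨ swap x i (1ℚ + 2ℚ * l) ⟩
      x * (1ℚ + 2ℚ * l) * i                      ≡⟨ cong (_* i) eq ⟩
      (1ℚ + 2ℚ * m) * i                          ≡⟨ split m l i ⟩
      i * (1ℚ + 2ℚ * l) + 2ℚ * ((m - l) * i)     ≡⟨ cong (_+ 2ℚ * ((m - l) * i)) il≡1 ⟩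
      1ℚ + 2ℚ * ((m - l) * i)                    ∎
      where
      swap : ∀ x i e → x * (i * e) ≡ x * e * i
      swap = solve-∀ ring
      split : ∀ a b i → (1ℚ + 2ℚ * a) * i ≡ i * (1ℚ + 2ℚ * b) + 2ℚ * ((a - b) * i)
      split = solve-∀ ring

    pole-quotient : ∀ k l → i * (1ℚ + 2ℚ * k) ≡ 1ℚ → x * (2ℚ * l) ≡ 1ℚ + 2ℚ * k →
                    2ℚ * (l * i) * x ≡ 1ℚ
    pole-quotient k l ik≡1 eq = begin
      2ℚ * (l * i) * x          ≡⟨ swap x i l ⟩
      i * (x * (2ℚ * l))        ≡⟨ cong (i *_) eq ⟩
      i * (1ℚ + 2ℚ * k)         ≡⟨ ik≡1 ⟩
      1ℚ                        ∎
      where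
      swap : ∀ x i a → 2ℚ * (a * i) * x ≡ i * (x * (2ℚ * a))
      swap = solve-∀ ring

  2∣ : ∀ k → 2 ∣ ℤ.∣ + 2 ℤ.* k ∣
  2∣ k = divides ℤ.∣ k ∣ (trans (ℤP.abs-* (+ 2) k) (ℕP.*-comm 2 ℤ.∣ k ∣))

  class-quotient : ∀ {x n d} → Parity n → Parity d → ¬ (2 ∣ ℤ.∣ n ∣ × 2 ∣ ℤ.∣ d ∣) →
                   x * ι d ≡ ι n → Class₂ x
  class-quotient (even k) (even l) coprime _ = contradiction (2∣ k , 2∣ l) coprime
  class-quotient {x} (even k) (odd l) _ eq =
    let i , il≡1 = inverse (odd-≢0 (integral-ι l)) in
    even (ι k * i) (integral-* (integral-ι k) (odd-unit (integral-ι l) il≡1))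
      (even-quotient (ι k) (ι l) il≡1 (trans (cong (x *_) (ι-odd l)) (trans eq (sym (ι-2* k)))))
  class-quotient {x} (odd k) (odd l) _ eq =
    let i , il≡1 = inverse (odd-≢0 (integral-ι l)) in
    odd ((ι k - ι l) * i)
      (integral-* (integral-- (integral-ι k) (integral-ι l)) (odd-unit (integral-ι l) il≡1))
      (odd-quotient (ι k) (ι l) il≡1 (trans (cong (x *_) (ι-odd l)) (trans eq (sym (ι-odd k)))))
  class-quotient {x} (odd k) (even l) _ eq =
    let i , ik≡1 = inverse (odd-≢0 (integral-ι k)) in
    pole (ι l * i) (integral-* (integral-ι l) (odd-unit (integral-ι k) ik≡1))
      (pole-quotient (ι k) (ι l) ik≡1 (trans (cong (x *_) (ι-2* l)) (trans eq (sym (ι-odd k)))))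

  reduced : ∀ x → ¬ (2 ∣ ℤ.∣ ℚ.numerator x ∣ × 2 ∣ ℤ.∣ ℚ.denominator x ∣)
  reduced (mkℚ n d-1 c) 2∣both = contradiction (Coprimality.recompute c 2∣both) λ ()

class₂ : ∀ x → Class₂ x
class₂ x = class-quotient (parity (ℚ.numerator x)) (parity (ℚ.denominator x)) (reduced x) (*-denominator x)

-- ℤ₍₂₎ is integrally closed: a pole 2yx = 1 squares to 1 = 2(2y²x²). This serves to bound a product
-- of two ordinates that is known only through its square.
Integral-sqrt : ∀ {x} → Integral (x * x) → Integral x
Integral-sqrt {x} p with class₂ x
... | even y q refl = integral-* integral-2 q
... | odd  y q refl = integral-+ integral-1 (integral-* integral-2 q)
... | pole y q 2yx≡1 = contradiction
  (trans (cong₂ _*_ (sym 2yx≡1) (sym 2yx≡1)) (shuffle x y))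
  (½-not-integral (integral-* (integral-* (integral-* integral-2 q) q) p))
  where
  shuffle : ∀ x y → (2ℚ * y * x) * (2ℚ * y * x) ≡ 2ℚ * (2ℚ * y * y * (x * x))
  shuffle = solve-∀ ring

-- Chord and tangent addition

÷-cancel : ∀ x y .{{_ : NonZero y}} → x ÷ y * y ≡ x
÷-cancel x y = trans (*-assoc x (1/ y) y) (trans (cong (x *_) (*-inverseˡ y)) (*-identityʳ x))

x+x≡0⇒x≡0 : ∀ {x} → x + x ≡ 0ℚ → x ≡ 0ℚ
x+x≡0⇒x≡0 {x} 2x≡0 = *-cancelˡ 2ℚ (λ ()) (trans (double x) 2x≡0)
  where
  double : ∀ x → 2ℚ * x ≡ x + x
  double = solve-∀ ring

neg : Pt → Pt
neg O         = O
neg (aff x y) = aff x (- y)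

aff-injective : ∀ {x y x′ y′} → aff x y ≡ aff x′ y′ → x ≡ x′ × y ≡ y′
aff-injective refl = refl , refl

data On (A B : ℚ) : Pt → Set where
  O   : On A B O
  aff : ∀ {x y} → OnCurve A B x y → On A B (aff x y)

-- Slope of the chord and of the tangent at once: the second equation is the chord equation multiplied by
-- (y₁ + y₂)/(x₂ - x₁), and becomes the tangent equation when the points coincide.
record Slope (A x₁ y₁ x₂ y₂ l : ℚ) : Set where
  constructor slope
  field
    chord   : y₂ ≡ y₁ + l * (x₂ - x₁)
    tangent : A ≡ l * (y₁ + y₂) - x₁ * x₁ - x₁ * x₂ - x₂ * x₂

thirdX : ℚ → ℚ → ℚ → ℚ
thirdX l x₁ x₂ = l * l - x₁ - x₂

thirdY : ℚ → ℚ → ℚ → ℚ → ℚ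
thirdY l x₁ y₁ x₂ = l * (x₁ - thirdX l x₁ x₂) - y₁

add-vertical : ∀ A x₁ y₁ x₂ y₂ → x₂ - x₁ ≡ 0ℚ → y₁ + y₂ ≡ 0ℚ → add A (aff x₁ y₁) (aff x₂ y₂) ≡ O
add-vertical A x₁ y₁ x₂ y₂ dx≡0 sy≡0 with (x₂ - x₁) ≟ 0ℚ
... | no dx≢0 = contradiction dx≡0 dx≢0
... | yes _ with (y₁ + y₂) ≟ 0ℚ
...   | yes _   = refl
...   | no sy≢0 = contradiction sy≡0 sy≢0

-- Each equation of `Slope` determines l where its coefficient is nonzero: the chord when x₁ ≠ x₂,
-- the tangent when y₁ + y₂ ≠ 0. A sum can thus be read off from any exhibited slope.
add-third : ∀ {A x₁ y₁ x₂ y₂ l} → Slope A x₁ y₁ x₂ y₂ l → ¬ (x₂ - x₁ ≡ 0ℚ × y₁ + y₂ ≡ 0ℚ) →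
            add A (aff x₁ y₁) (aff x₂ y₂) ≡ third l x₁ y₁ x₂
add-third {A} {x₁} {y₁} {x₂} {y₂} {l} (slope ch tg) ¬vertical with (x₂ - x₁) ≟ 0ℚ
... | no dx≢0 = cong (λ k → third k x₁ y₁ x₂)
  (*-cancelˡ (x₂ - x₁) {m} {l} dx≢0
    (trans (*-comm (x₂ - x₁) m) (trans (÷-cancel (y₂ - y₁) (x₂ - x₁)) (rearrange x₁ y₁ x₂ y₂ l ch))))
  where
  instance dx-nonZero = ≢-nonZero dx≢0
  m = (y₂ - y₁) ÷ (x₂ - x₁)
  rearrange : ∀ x₁ y₁ x₂ y₂ l → y₂ ≡ y₁ + l * (x₂ - x₁) → y₂ - y₁ ≡ (x₂ - x₁) * l
  rearrange x₁ y₁ x₂ _ l refl = identity x₁ y₁ x₂ l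
    where
    identity : ∀ x₁ y₁ x₂ l → y₁ + l * (x₂ - x₁) - y₁ ≡ (x₂ - x₁) * l
    identity = solve-∀ ring
... | yes dx≡0 with (y₁ + y₂) ≟ 0ℚ
...   | yes sy≡0 = contradiction (dx≡0 , sy≡0) ¬vertical
...   | no sy≢0 = cong (λ k → third k x₁ y₁ x₂)
  (*-cancelˡ (y₁ + y₂) {m} {l} sy≢0
    (trans (*-comm (y₁ + y₂) m)
      (trans (÷-cancel (3ℚ * x₁ * x₁ + A) (y₁ + y₂)) (rearrange x₁ x₂ (x-y≡0⇒x≡y dx≡0) tg))))
  where
  instance sy-nonZero = ≢-nonZero sy≢0
  m = (3ℚ * x₁ * x₁ + A) ÷ (y₁ + y₂)
  rearrange : ∀ x₁ x₂ → x₂ ≡ x₁ → A ≡ l * (y₁ + y₂) - x₁ * x₁ - x₁ * x₂ - x₂ * x₂ →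
              3ℚ * x₁ * x₁ + A ≡ (y₁ + y₂) * l
  rearrange x₁ _ refl tg = trans (cong (λ z → 3ℚ * x₁ * x₁ + z) tg) (identity x₁ y₁ y₂ l)
    where
    identity : ∀ x₁ y₁ y₂ l → 3ℚ * x₁ * x₁ + (l * (y₁ + y₂) - x₁ * x₁ - x₁ * x₁ - x₁ * x₁) ≡ (y₁ + y₂) * l
    identity = solve-∀ ring

-- A view of the value of `add` in which chord and tangent form one case. The negated condition is
-- kept because `neg-add` has to evaluate a second, reflected sum.
data Sum (A x₁ y₁ x₂ y₂ : ℚ) : Pt → Set where
  vertical : x₂ - x₁ ≡ 0ℚ → y₁ + y₂ ≡ 0ℚ → Sum A x₁ y₁ x₂ y₂ O
  sloped   : ∀ l → Slope A x₁ y₁ x₂ y₂ l → ¬ (x₂ - x₁ ≡ 0ℚ × y₁ + y₂ ≡ 0ℚ) →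
             Sum A x₁ y₁ x₂ y₂ (third l x₁ y₁ x₂)

private
  -- Subtracting the two curve equations eliminates B. Dividing by x₂ - x₁ then yields the `tangent`
  -- field of a chord.
  difference : ∀ {A B x₁ y₁ x₂ y₂} → On A B (aff x₁ y₁) → On A B (aff x₂ y₂) →
               (y₂ - y₁) * (y₁ + y₂) ≡ (x₂ - x₁) * (x₁ * x₁ + x₁ * x₂ + x₂ * x₂ + A)
  difference {A} {B} {x₁} {y₁} {x₂} {y₂} (aff on₁) (aff on₂) = begin
    (y₂ - y₁) * (y₁ + y₂)                                           ≡⟨ squares y₁ y₂ ⟩
    y₂ * y₂ - y₁ * y₁                                               ≡⟨ cong₂ _-_ on₂ on₁ ⟩
    x₂ * x₂ * x₂ + A * x₂ + B - (x₁ * x₁ * x₁ + A * x₁ + B)         ≡⟨ cubes A B x₁ x₂ ⟩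
    (x₂ - x₁) * (x₁ * x₁ + x₁ * x₂ + x₂ * x₂ + A)                   ∎
    where
    open ≡-Reasoning
    squares : ∀ y₁ y₂ → (y₂ - y₁) * (y₁ + y₂) ≡ y₂ * y₂ - y₁ * y₁
    squares = solve-∀ ring
    cubes : ∀ A B x₁ x₂ → x₂ * x₂ * x₂ + A * x₂ + B - (x₁ * x₁ * x₁ + A * x₁ + B)
                        ≡ (x₂ - x₁) * (x₁ * x₁ + x₁ * x₂ + x₂ * x₂ + A)
    cubes = solve-∀ ring

  isolate-tangent : ∀ A x₁ x₂ {t} → t ≡ x₁ * x₁ + x₁ * x₂ + x₂ * x₂ + A →
                    A ≡ t - x₁ * x₁ - x₁ * x₂ - x₂ * x₂
  isolate-tangent A x₁ x₂ refl = identity A x₁ x₂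
    where
    identity : ∀ A x₁ x₂ → A ≡ x₁ * x₁ + x₁ * x₂ + x₂ * x₂ + A - x₁ * x₁ - x₁ * x₂ - x₂ * x₂
    identity = solve-∀ ring

chord-slope : ∀ {A B x₁ y₁ x₂ y₂ l} → On A B (aff x₁ y₁) → On A B (aff x₂ y₂) →
              x₂ - x₁ ≢ 0ℚ → l * (x₂ - x₁) ≡ y₂ - y₁ → Slope A x₁ y₁ x₂ y₂ l
chord-slope {A} {B} {x₁} {y₁} {x₂} {y₂} {l} on₁ on₂ dx≢0 eq = slope
  (trans (split y₁ y₂) (cong (λ z → y₁ + z) (sym eq)))
  (isolate-tangent A x₁ x₂ (*-cancelˡ (x₂ - x₁) dx≢0 (begin
    (x₂ - x₁) * (l * (y₁ + y₂))                     ≡⟨ regroup (x₂ - x₁) l (y₁ + y₂) ⟩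
    l * (x₂ - x₁) * (y₁ + y₂)                       ≡⟨ cong (_* (y₁ + y₂)) eq ⟩
    (y₂ - y₁) * (y₁ + y₂)                           ≡⟨ difference on₁ on₂ ⟩
    (x₂ - x₁) * (x₁ * x₁ + x₁ * x₂ + x₂ * x₂ + A)   ∎)))
  where
  open ≡-Reasoning
  split : ∀ y₁ y₂ → y₂ ≡ y₁ + (y₂ - y₁)
  split = solve-∀ ring
  regroup : ∀ d l s → d * (l * s) ≡ l * d * s
  regroup = solve-∀ ring

tangent-slope : ∀ {A x y l} → l * (y + y) ≡ 3ℚ * x * x + A → Slope A x y x y l
tangent-slope {A} {x} {y} {l} eq = slope (chord x y l) (isolate-tangent A x x (trans eq (triple A x)))
  where
  chord : ∀ x y l → y ≡ y + l * (x - x)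
  chord = solve-∀ ring
  triple : ∀ A x → 3ℚ * x * x + A ≡ x * x + x * x + x * x + A
  triple = solve-∀ ring

private
  same-x⇒same-y : ∀ {A B x₁ y₁ x₂ y₂} → On A B (aff x₁ y₁) → On A B (aff x₂ y₂) →
                  x₂ - x₁ ≡ 0ℚ → y₁ + y₂ ≢ 0ℚ → y₂ ≡ y₁
  same-x⇒same-y {A} {B} {x₁} {y₁} {x₂} {y₂} on₁ on₂ dx≡0 sy≢0 =
    x-y≡0⇒x≡y (*-cancelˡ (y₁ + y₂) {y₂ - y₁} {0ℚ} sy≢0 (begin
      (y₁ + y₂) * (y₂ - y₁)                           ≡⟨ *-comm (y₁ + y₂) (y₂ - y₁) ⟩
      (y₂ - y₁) * (y₁ + y₂)                           ≡⟨ difference on₁ on₂ ⟩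
      (x₂ - x₁) * (x₁ * x₁ + x₁ * x₂ + x₂ * x₂ + A)   ≡⟨ cong (_* (x₁ * x₁ + x₁ * x₂ + x₂ * x₂ + A)) dx≡0 ⟩
      0ℚ * (x₁ * x₁ + x₁ * x₂ + x₂ * x₂ + A)          ≡⟨ *-zeroˡ (x₁ * x₁ + x₁ * x₂ + x₂ * x₂ + A) ⟩
      0ℚ                                              ≡⟨ *-zeroʳ (y₁ + y₂) ⟨
      (y₁ + y₂) * 0ℚ                                  ∎))
    where open ≡-Reasoning

add-sum : ∀ {A B x₁ y₁ x₂ y₂} → On A B (aff x₁ y₁) → On A B (aff x₂ y₂) →
          Sum A x₁ y₁ x₂ y₂ (add A (aff x₁ y₁) (aff x₂ y₂))
add-sum {A} {B} {x₁} {y₁} {x₂} {y₂} on₁ on₂ with (x₂ - x₁) ≟ 0ℚ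
... | no dx≢0 = sloped l
  (chord-slope on₁ on₂ dx≢0 (÷-cancel (y₂ - y₁) (x₂ - x₁)))
  (dx≢0 ∘ proj₁)
  where
  instance dx-nonZero = ≢-nonZero dx≢0
  l = (y₂ - y₁) ÷ (x₂ - x₁)
... | yes dx≡0 with (y₁ + y₂) ≟ 0ℚ
...   | yes sy≡0 = vertical dx≡0 sy≡0
...   | no sy≢0 = sloped l
  (at (x-y≡0⇒x≡y dx≡0) (same-x⇒same-y on₁ on₂ dx≡0 sy≢0)
      (÷-cancel (3ℚ * x₁ * x₁ + A) (y₁ + y₂)))
  (sy≢0 ∘ proj₂)
  where
  instance sy-nonZero = ≢-nonZero sy≢0
  l = (3ℚ * x₁ * x₁ + A) ÷ (y₁ + y₂)
  at : ∀ {A x₁ y₁ x₂ y₂ l} → x₂ ≡ x₁ → y₂ ≡ y₁ → l * (y₁ + y₂) ≡ 3ℚ * x₁ * x₁ + A → Slope A x₁ y₁ x₂ y₂ l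
  at refl refl = tangent-slope

-- `Slope` expresses y₂ and A, and the first point expresses B, as polynomials in l, x₁, y₁, x₂;
-- after substitution the claim is a polynomial identity.
third-onCurve : ∀ {A B x₁ y₁ x₂ y₂ l} → On A B (aff x₁ y₁) → Slope A x₁ y₁ x₂ y₂ l →
                On A B (third l x₁ y₁ x₂)
third-onCurve {A} {B} {x₁} {y₁} {x₂} {y₂} {l} (aff on₁) (slope ch tg) = aff (go A B y₂ ch tg (isolate-B A B x₁ y₁ on₁))
  where
  isolate-B : ∀ A B x y → OnCurve A B x y → B ≡ y * y - x * x * x - A * x
  isolate-B A B x y on = trans (identity A B x) (cong (λ z → z - x * x * x - A * x) (sym on))
    where
    identity : ∀ A B x → B ≡ x * x * x + A * x + B - x * x * x - A * x
    identity = solve-∀ ring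
  go : ∀ A B y₂ → y₂ ≡ y₁ + l * (x₂ - x₁) → A ≡ l * (y₁ + y₂) - x₁ * x₁ - x₁ * x₂ - x₂ * x₂ →
       B ≡ y₁ * y₁ - x₁ * x₁ * x₁ - A * x₁ → OnCurve A B (thirdX l x₁ x₂) (thirdY l x₁ y₁ x₂)
  go _ _ _ refl refl refl = identity l x₁ y₁ x₂
    where
    identity : ∀ l x₁ y₁ x₂ →
      let A  = l * (y₁ + (y₁ + l * (x₂ - x₁))) - x₁ * x₁ - x₁ * x₂ - x₂ * x₂
          B  = y₁ * y₁ - x₁ * x₁ * x₁ - A * x₁
          x₃ = l * l - x₁ - x₂
          y₃ = l * (x₁ - x₃) - y₁
      in y₃ * y₃ ≡ x₃ * x₃ * x₃ + A * x₃ + B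
    identity = solve-∀ ring

-- Reflect the line through P, Q and -(P + Q) in the x-axis.
slope-back : ∀ {A x₁ y₁ x₂ y₂ l} → Slope A x₁ y₁ x₂ y₂ l →
             Slope A x₁ (- y₁) (thirdX l x₁ x₂) (thirdY l x₁ y₁ x₂) (- l)
slope-back {A} {x₁} {y₁} {x₂} {y₂} {l} (slope ch tg) = go A y₂ ch tg
  where
  chord : ∀ l x₁ y₁ x₂ → l * (x₁ - (l * l - x₁ - x₂)) - y₁ ≡ - y₁ + - l * (l * l - x₁ - x₂ - x₁)
  chord = solve-∀ ring
  tangent : ∀ l x₁ y₁ x₂ → let x₃ = l * l - x₁ - x₂ in
    l * (y₁ + (y₁ + l * (x₂ - x₁))) - x₁ * x₁ - x₁ * x₂ - x₂ * x₂
    ≡ - l * (- y₁ + (l * (x₁ - x₃) - y₁)) - x₁ * x₁ - x₁ * x₃ - x₃ * x₃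
  tangent = solve-∀ ring
  go : ∀ A y₂ → y₂ ≡ y₁ + l * (x₂ - x₁) → A ≡ l * (y₁ + y₂) - x₁ * x₁ - x₁ * x₂ - x₂ * x₂ →
       Slope A x₁ (- y₁) (thirdX l x₁ x₂) (thirdY l x₁ y₁ x₂) (- l)
  go _ _ refl refl = slope (chord l x₁ y₁ x₂) (tangent l x₁ y₁ x₂)

slope-neg : ∀ {A x₁ y₁ x₂ y₂ l} → Slope A x₁ y₁ x₂ y₂ l → Slope A x₁ (- y₁) x₂ (- y₂) (- l)
slope-neg {A} {x₁} {y₁} {x₂} {y₂} {l} (slope ch tg) = slope
  (trans (cong -_ ch) (chord l x₁ y₁ x₂)) (trans tg (tangent l x₁ y₁ x₂ y₂))
  where
  chord : ∀ l x₁ y₁ x₂ → - (y₁ + l * (x₂ - x₁)) ≡ - y₁ + - l * (x₂ - x₁)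
  chord = solve-∀ ring
  tangent : ∀ l x₁ y₁ x₂ y₂ → l * (y₁ + y₂) - x₁ * x₁ - x₁ * x₂ - x₂ * x₂
                            ≡ - l * (- y₁ + - y₂) - x₁ * x₁ - x₁ * x₂ - x₂ * x₂
  tangent = solve-∀ ring

-- Closure, negation and cancellation.

on-neg : ∀ {A B P} → On A B P → On A B (neg P)
on-neg O        = O
on-neg {A} {B} (aff {x} {y} on) = aff (trans (square y) on)
  where
  square : ∀ y → - y * - y ≡ y * y
  square = solve-∀ ring

on-add : ∀ {A B P Q} → On A B P → On A B Q → On A B (add A P Q)
on-add O q = q
on-add on₁@(aff _) O = on₁
on-add {A} {B} {aff x₁ y₁} {aff x₂ y₂} on₁@(aff _) on₂@(aff _)
  with add A (aff x₁ y₁) (aff x₂ y₂) | add-sum on₁ on₂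
... | _ | vertical _ _   = O
... | _ | sloped l sl _  = third-onCurve on₁ sl

neg-add : ∀ {A B P Q} → On A B P → On A B Q → add A (neg P) (neg Q) ≡ neg (add A P Q)
neg-add O q = refl
neg-add (aff on₁) O = refl
neg-add {A} {B} {aff x₁ y₁} {aff x₂ y₂} on₁@(aff _) on₂@(aff _)
  with add A (aff x₁ y₁) (aff x₂ y₂) | add-sum on₁ on₂
... | _ | vertical dx≡0 sy≡0 = add-vertical A x₁ (- y₁) x₂ (- y₂) dx≡0 (trans (neg-sum y₁ y₂) (cong -_ sy≡0))
  where
  neg-sum : ∀ y₁ y₂ → - y₁ + - y₂ ≡ - (y₁ + y₂)
  neg-sum = solve-∀ ring
... | _ | sloped l sl ¬vertical = trans
  (add-third (slope-neg sl) λ (dx≡0 , sy≡0) → ¬vertical (dx≡0 , trans (neg-neg-sum y₁ y₂) (cong -_ sy≡0)))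
  (cong₂ aff (third-x l x₁ x₂) (third-y l x₁ y₁ x₂))
  where
  neg-neg-sum : ∀ y₁ y₂ → y₁ + y₂ ≡ - (- y₁ + - y₂)
  neg-neg-sum = solve-∀ ring
  third-x : ∀ l x₁ x₂ → - l * - l - x₁ - x₂ ≡ l * l - x₁ - x₂
  third-x = solve-∀ ring
  third-y : ∀ l x₁ y₁ x₂ → - l * (x₁ - (- l * - l - x₁ - x₂)) - - y₁ ≡ - (l * (x₁ - (l * l - x₁ - x₂)) - y₁)
  third-y = solve-∀ ring

-- By `slope-back`, -P and P + Q lie on the reflected line, whose remaining intersection is -Q;
-- reflecting it returns Q.
add-neg-cancel : ∀ {A B x₁ y₁ Q} → On A B (aff x₁ y₁) → y₁ ≢ 0ℚ → On A B Q →
                 add A (neg (aff x₁ y₁)) (add A (aff x₁ y₁) Q) ≡ Q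
add-neg-cancel {A} {x₁ = x₁} {y₁} on₁ y₁≢0 O = add-vertical A x₁ (- y₁) x₁ y₁ (+-inverseʳ x₁) (+-inverseˡ y₁)
add-neg-cancel {A} {B} {x₁} {y₁} {aff x₂ y₂} on₁ y₁≢0 on₂@(aff _)
  with add A (aff x₁ y₁) (aff x₂ y₂) | add-sum on₁ on₂
... | _ | vertical dx≡0 sy≡0 = cong₂ aff (sym (x-y≡0⇒x≡y dx≡0)) (x-y≡0⇒x≡y (trans (neg-sum y₁ y₂) (cong -_ sy≡0)))
  where
  neg-sum : ∀ y₁ y₂ → - y₁ - y₂ ≡ - (y₁ + y₂)
  neg-sum = solve-∀ ring
... | _ | sloped l sl _ = trans
  -- If x₃ = x₁, the formula for the third point gives y₃ = -y₁; a vertical second sum would also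
  -- need y₃ = y₁, hence 2y₁ = 0.
  (add-third (slope-back sl) λ (dx≡0 , sy≡0) → y₁≢0 (x+x≡0⇒x≡0 (double l x₁ y₁ x₂ dx≡0 sy≡0)))
  (cong₂ aff (back-x l x₁ x₂) (trans (back-y l x₁ y₁ x₂) (sym (Slope.chord sl))))
  where
  double : ∀ l x₁ y₁ x₂ → thirdX l x₁ x₂ - x₁ ≡ 0ℚ → - y₁ + thirdY l x₁ y₁ x₂ ≡ 0ℚ → y₁ + y₁ ≡ 0ℚ
  double l x₁ y₁ x₂ dx≡0 sy≡0 = trans (identity l x₁ y₁ (thirdX l x₁ x₂))
    (cong₂ (λ a b → - l * a - b) dx≡0 sy≡0 ∙ zero-case l)
    where
    _∙_ = trans
    identity : ∀ l x₁ y₁ x₃ → y₁ + y₁ ≡ - l * (x₃ - x₁) - (- y₁ + (l * (x₁ - x₃) - y₁))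
    identity = solve-∀ ring
    zero-case : ∀ l → - l * 0ℚ - 0ℚ ≡ 0ℚ
    zero-case = solve-∀ ring
  back-x : ∀ l x₁ x₂ → - l * - l - x₁ - (l * l - x₁ - x₂) ≡ x₂
  back-x = solve-∀ ring
  back-y : ∀ l x₁ y₁ x₂ → - l * (x₁ - (- l * - l - x₁ - (l * l - x₁ - x₂))) - - y₁ ≡ y₁ + l * (x₂ - x₁)
  back-y = solve-∀ ring

-- Points of infinite order

module _ {A B x₁ y₁ α β : ℚ} (α-int : Integral α) (β-int : Integral β) (x₁≢0 : x₁ ≢ 0ℚ)
         (A≡ : A ≡ 2ℚ * α * (x₁ * x₁)) (B≡ : B ≡ 2ℚ * β * (x₁ * x₁ * x₁))
         (on₁ : On A B (aff x₁ y₁)) where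

  open ≡-Reasoning

  private
    P : Pt
    P = aff x₁ y₁

    i = proj₁ (inverse x₁≢0)

    ix₁≡1 : i * x₁ ≡ 1ℚ
    ix₁≡1 = proj₂ (inverse x₁≢0)

    ∙2 : ∀ {x} → Integral x → Integral (2ℚ * x)
    ∙2 = integral-* integral-2

  -- Scaled by x₁, the curve reduces modulo 2 to the cusp Y² = X³; these are the points that avoid the cusp.
  data Regular : Pt → Set where
    O   : Regular O
    aff : ∀ {x y} ζ → Integral ζ → x₁ ≡ ζ * x → Regular (aff x y)

  -- Here t = x/x₁ is the scaled abscissa. Since x₁ may fail to be a square, the scaling is a
  -- quadratic twist: y itself has no rational rescaling, while y²/x₁³ does make sense.
  scaled-curve : ∀ {x y} t → x ≡ t * x₁ → On A B (aff x y) →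
                 y * y ≡ x₁ * x₁ * x₁ * (t * t * t + 2ℚ * α * t + 2ℚ * β)
  scaled-curve {x} {y} t refl (aff on) = begin
    y * y                                                                     ≡⟨ on ⟩
    x * x * x + A * x + B                                                     ≡⟨ cong₂ (λ a b → x * x * x + a * x + b) A≡ B≡ ⟩
    x * x * x + 2ℚ * α * (x₁ * x₁) * x + 2ℚ * β * (x₁ * x₁ * x₁)              ≡⟨ factor x₁ t α β ⟩
    x₁ * x₁ * x₁ * (t * t * t + 2ℚ * α * t + 2ℚ * β)                          ∎
    where
    factor : ∀ x₁ t α β → let x = t * x₁ in
      x * x * x + 2ℚ * α * (x₁ * x₁) * x + 2ℚ * β * (x₁ * x₁ * x₁)
      ≡ x₁ * x₁ * x₁ * (t * t * t + 2ℚ * α * t + 2ℚ * β)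
    factor = solve-∀ ring

  -- Expanding in ζ = x₁/x instead of x/x₁ keeps the last factor odd even where x/x₁ has a pole.
  regular-curve : ∀ {x y} ζ → x₁ ≡ ζ * x → On A B (aff x y) →
                  y * y ≡ x * x * x * (1ℚ + 2ℚ * (α * ζ * ζ + β * ζ * ζ * ζ))
  regular-curve {x} {y} ζ x₁≡ (aff on) = begin
    y * y                                                                     ≡⟨ on ⟩
    x * x * x + A * x + B                                                     ≡⟨ cong₂ (λ a b → x * x * x + a * x + b) A≡ B≡ ⟩
    x * x * x + 2ℚ * α * (x₁ * x₁) * x + 2ℚ * β * (x₁ * x₁ * x₁)              ≡⟨ cong (λ z → x * x * x + 2ℚ * α * (z * z) * x + 2ℚ * β * (z * z * z)) x₁≡ ⟩
    x * x * x + 2ℚ * α * (ζ * x * (ζ * x)) * x + 2ℚ * β * (ζ * x * (ζ * x) * (ζ * x)) ≡⟨ factor x ζ α β ⟩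
    x * x * x * (1ℚ + 2ℚ * (α * ζ * ζ + β * ζ * ζ * ζ))                       ∎
    where
    factor : ∀ x ζ α β →
      x * x * x + 2ℚ * α * (ζ * x * (ζ * x)) * x + 2ℚ * β * (ζ * x * (ζ * x) * (ζ * x))
      ≡ x * x * x * (1ℚ + 2ℚ * (α * ζ * ζ + β * ζ * ζ * ζ))
    factor = solve-∀ ring

  regular-x≢0 : ∀ {x} ζ → x₁ ≡ ζ * x → x ≢ 0ℚ
  regular-x≢0 ζ x₁≡ refl = x₁≢0 (trans x₁≡ (*-zeroʳ ζ))

  cubic-int : ∀ {ζ} → Integral ζ → Integral (α * ζ * ζ + β * ζ * ζ * ζ)
  cubic-int ζ-int = integral-+ (integral-* (integral-* α-int ζ-int) ζ-int)
                               (integral-* (integral-* (integral-* β-int ζ-int) ζ-int) ζ-int)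

  regular-y≢0 : ∀ {x y} → Regular (aff x y) → On A B (aff x y) → y ≢ 0ℚ
  regular-y≢0 {x} {y} (aff ζ ζ-int x₁≡) on refl =
    *-≢0 (*-≢0 (*-≢0 x≢0 x≢0) x≢0) (odd-≢0 (cubic-int ζ-int)) (sym (regular-curve ζ x₁≡ on))
    where x≢0 = regular-x≢0 ζ x₁≡

  regular-P : Regular P
  regular-P = aff 1ℚ integral-1 (sym (*-identityˡ x₁))

  y₁≢0 : y₁ ≢ 0ℚ
  y₁≢0 = regular-y≢0 regular-P on₁

  data Singular : Pt → Set where
    aff : ∀ {x y} σ → Integral σ → x ≡ 2ℚ * σ * x₁ → Singular (aff x y)

  -- Of the three classes of x/x₁ modulo 2, only 0 is the abscissa of the cusp; 1 and ∞ are regular.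
  regular⊎singular : ∀ R → Regular R ⊎ Singular R
  regular⊎singular O = inj₁ O
  regular⊎singular (aff x y) with class₂ (i * x)
  ... | even σ σ-int ix≡ = inj₂ (aff σ σ-int (begin
    x                 ≡⟨ unscale ⟩
    i * x * x₁        ≡⟨ cong (_* x₁) ix≡ ⟩
    2ℚ * σ * x₁       ∎))
    where
    shuffle : ∀ i x x₁ → i * x₁ * x ≡ i * x * x₁
    shuffle = solve-∀ ring
    unscale : x ≡ i * x * x₁
    unscale = trans (sym (*-identityˡ x)) (trans (cong (_* x) (sym ix₁≡1)) (shuffle i x x₁))
  ... | odd ρ ρ-int ix≡ = inj₁ (aff ζ (odd-unit ρ-int (proj₂ unit)) (begin
    x₁                                ≡⟨ *-identityˡ x₁ ⟨
    1ℚ * x₁                           ≡⟨ cong (_* x₁) (proj₂ unit) ⟨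
    ζ * (1ℚ + 2ℚ * ρ) * x₁            ≡⟨ cong (λ z → ζ * z * x₁) ix≡ ⟨
    ζ * (i * x) * x₁                  ≡⟨ shuffle ζ i x x₁ ⟩
    i * x₁ * (ζ * x)                  ≡⟨ cong (_* (ζ * x)) ix₁≡1 ⟩
    1ℚ * (ζ * x)                      ≡⟨ *-identityˡ (ζ * x) ⟩
    ζ * x                             ∎))
    where
    unit = inverse (odd-≢0 ρ-int)
    ζ = proj₁ unit
    shuffle : ∀ ζ i x x₁ → ζ * (i * x) * x₁ ≡ i * x₁ * (ζ * x)
    shuffle = solve-∀ ring
  ... | pole ρ ρ-int 2ρix≡1 = inj₁ (aff (2ℚ * ρ) (∙2 ρ-int) (begin
    x₁                                ≡⟨ *-identityˡ x₁ ⟨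
    1ℚ * x₁                           ≡⟨ cong (_* x₁) 2ρix≡1 ⟨
    2ℚ * ρ * (i * x) * x₁             ≡⟨ shuffle (2ℚ * ρ) i x x₁ ⟩
    i * x₁ * (2ℚ * ρ * x)             ≡⟨ cong (_* (2ℚ * ρ * x)) ix₁≡1 ⟩
    1ℚ * (2ℚ * ρ * x)                 ≡⟨ *-identityˡ (2ℚ * ρ * x) ⟩
    2ℚ * ρ * x                        ∎))
    where
    shuffle : ∀ ζ i x x₁ → ζ * (i * x) * x₁ ≡ i * x₁ * (ζ * x)
    shuffle = solve-∀ ring

  regular∧singular⇒⊥ : ∀ {R} → Regular R → Singular R → ⊥
  regular∧singular⇒⊥ (aff {x} ζ ζ-int x₁≡) (aff σ σ-int x≡) =
    ½-not-integral (integral-* σ-int ζ-int) (*-cancelˡ x₁ {1ℚ} {2ℚ * (σ * ζ)} x₁≢0 (begin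
      x₁ * 1ℚ                ≡⟨ *-identityʳ x₁ ⟩
      x₁                     ≡⟨ x₁≡ ⟩
      ζ * x                  ≡⟨ cong (ζ *_) x≡ ⟩
      ζ * (2ℚ * σ * x₁)      ≡⟨ shuffle ζ σ x₁ ⟩
      x₁ * (2ℚ * (σ * ζ))    ∎))
    where
    shuffle : ∀ ζ σ x₁ → ζ * (2ℚ * σ * x₁) ≡ x₁ * (2ℚ * (σ * ζ))
    shuffle = solve-∀ ring

  -- A line through -P and the cusp meets the reduced curve in no further regular point.
  singular-sub : ∀ {S} → Singular S → On A B S → Singular (add A (neg P) S)
  singular-sub {aff x₃ y₃} (aff σ σ-int x₃≡) on₃
    with add A (aff x₁ (- y₁)) (aff x₃ y₃) | add-sum (on-neg on₁) on₃
  -- (x₃ - x₁)/x₁ = 2σ - 1 is odd; it is written 1 + 2(σ - 1) to fit `odd-≢0`.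
  ... | _ | vertical dx≡0 _ = ⊥-elim (*-≢0 x₁≢0 (odd-≢0 (integral-- σ-int integral-1)) (begin
    x₁ * (1ℚ + 2ℚ * (σ - 1ℚ))    ≡⟨ factor x₁ σ ⟨
    2ℚ * σ * x₁ - x₁             ≡⟨ cong (_- x₁) x₃≡ ⟨
    x₃ - x₁                      ≡⟨ dx≡0 ⟩
    0ℚ                           ∎))
    where
    factor : ∀ x₁ σ → 2ℚ * σ * x₁ - x₁ ≡ x₁ * (1ℚ + 2ℚ * (σ - 1ℚ))
    factor = solve-∀ ring
  ... | _ | sloped l (slope chord _) _ = aff ρ ρ-int x′≡
    where
    unit = inverse (odd-≢0 (integral-- σ-int integral-1))
    j = proj₁ unit
    j-int : Integral j
    j-int = odd-unit (integral-- σ-int integral-1) (proj₂ unit)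

    -- `E` and `F` are the scaled cubic at t = 2σ and t = 1, and `w` is y₁y₃/x₁³. Then E + 2w + F =
    -- 1 + 2κ is odd, and `ρ` is half of the new scaled abscissa j²(E + 2w + F) - 1 - 2σ, where j =
    -- 1/(2σ - 1).
    E F w κ ρ : ℚ
    E = 2ℚ * σ * (2ℚ * σ) * (2ℚ * σ) + 2ℚ * α * (2ℚ * σ) + 2ℚ * β
    F = 1ℚ * 1ℚ * 1ℚ + 2ℚ * α * 1ℚ + 2ℚ * β
    w = i * i * i * (y₁ * y₃)
    κ = 2ℚ * (2ℚ * (σ * σ * σ)) + 2ℚ * (α * σ) + β + w + α + β
    ρ = 2ℚ * (σ * σ * j * j - σ * j) + κ * j * j - σ

    x₁³ : ℚ
    x₁³ = x₁ * x₁ * x₁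

    i³x₁³≡1 : i * i * i * x₁³ ≡ 1ℚ
    i³x₁³≡1 = trans (shuffle i x₁) (cong (λ z → z * z * z) ix₁≡1)
      where
      shuffle : ∀ i x → i * i * i * (x * x * x) ≡ (i * x) * (i * x) * (i * x)
      shuffle = solve-∀ ring

    y₁²≡ : y₁ * y₁ ≡ x₁³ * F
    y₁²≡ = scaled-curve 1ℚ (sym (*-identityˡ x₁)) on₁

    y₃²≡ : y₃ * y₃ ≡ x₁³ * E
    y₃²≡ = scaled-curve (2ℚ * σ) x₃≡ on₃

    y₁y₃≡ : y₁ * y₃ ≡ x₁³ * w
    y₁y₃≡ = begin
      y₁ * y₃                             ≡⟨ *-identityˡ (y₁ * y₃) ⟨
      1ℚ * (y₁ * y₃)                      ≡⟨ cong (_* (y₁ * y₃)) i³x₁³≡1 ⟨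
      i * i * i * x₁³ * (y₁ * y₃)         ≡⟨ shuffle (i * i * i) x₁³ (y₁ * y₃) ⟩
      x₁³ * w                             ∎
      where
      shuffle : ∀ a b c → a * b * c ≡ b * (a * c)
      shuffle = solve-∀ ring

    w²≡ : w * w ≡ F * E
    w²≡ = begin
      w * w                                               ≡⟨ shuffle (i * i * i) y₁ y₃ ⟩
      i * i * i * (i * i * i) * (y₁ * y₁ * (y₃ * y₃))     ≡⟨ cong₂ (λ a b → i * i * i * (i * i * i) * (a * b)) y₁²≡ y₃²≡ ⟩
      i * i * i * (i * i * i) * (x₁³ * F * (x₁³ * E))     ≡⟨ regroup (i * i * i) x₁³ F E ⟩
      i * i * i * x₁³ * (i * i * i * x₁³) * (F * E)       ≡⟨ cong (λ z → z * z * (F * E)) i³x₁³≡1 ⟩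
      1ℚ * (F * E)                                        ≡⟨ *-identityˡ (F * E) ⟩
      F * E                                               ∎
      where
      shuffle : ∀ a y z → a * (y * z) * (a * (y * z)) ≡ a * a * (y * y * (z * z))
      shuffle = solve-∀ ring
      regroup : ∀ a b F E → a * a * (b * F * (b * E)) ≡ a * b * (a * b) * (F * E)
      regroup = solve-∀ ring

    cubic-integral : ∀ {t} → Integral t → Integral (t * t * t + 2ℚ * α * t + 2ℚ * β)
    cubic-integral t-int = integral-+
      (integral-+ (integral-* (integral-* t-int t-int) t-int) (integral-* (∙2 α-int) t-int)) (∙2 β-int)

    -- The ordinates cannot be scaled separately, but the square of their scaled product is the
    -- integral number FE.
    w-int : Integral w
    w-int = Integral-sqrt (subst Integral (sym w²≡)
      (integral-* (cubic-integral integral-1) (cubic-integral (∙2 σ-int))))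

    κ-int : Integral κ
    κ-int = integral-+ (integral-+ (integral-+ (integral-+ (integral-+
      (∙2 (∙2 (integral-* (integral-* σ-int σ-int) σ-int))) (∙2 (integral-* α-int σ-int))) β-int) w-int) α-int) β-int

    ρ-int : Integral ρ
    ρ-int = integral-- (integral-+
      (∙2 (integral-- (integral-* (integral-* (integral-* σ-int σ-int) j-int) j-int) (integral-* σ-int j-int)))
      (integral-* (integral-* κ-int j-int) j-int)) σ-int

    l≡ : l ≡ i * j * (y₃ + y₁)
    l≡ = begin
      l                                                ≡⟨ pad l ⟩
      1ℚ * 1ℚ * l                                      ≡⟨ cong₂ (λ a b → a * b * l) ix₁≡1 (proj₂ unit) ⟨
      i * x₁ * (j * (1ℚ + 2ℚ * (σ - 1ℚ))) * l          ≡⟨ shuffle i j x₁ y₁ σ l ⟩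
      i * j * (- y₁ + l * (2ℚ * σ * x₁ - x₁) + y₁)     ≡⟨ cong (λ z → i * j * (- y₁ + l * (z - x₁) + y₁)) x₃≡ ⟨
      i * j * (- y₁ + l * (x₃ - x₁) + y₁)              ≡⟨ cong (λ z → i * j * (z + y₁)) chord ⟨
      i * j * (y₃ + y₁)                                ∎
      where
      pad : ∀ l → l ≡ 1ℚ * 1ℚ * l
      pad = solve-∀ ring
      shuffle : ∀ i j x₁ y₁ σ l → i * x₁ * (j * (1ℚ + 2ℚ * (σ - 1ℚ))) * l
                              ≡ i * j * (- y₁ + l * (2ℚ * σ * x₁ - x₁) + y₁)
      shuffle = solve-∀ ring

    l²≡ : l * l ≡ x₁ * (j * j * (E + 2ℚ * w + F))
    l²≡ = begin
      l * l                                                              ≡⟨ cong (λ z → z * z) l≡ ⟩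
      i * j * (y₃ + y₁) * (i * j * (y₃ + y₁))                            ≡⟨ expand i j y₁ y₃ ⟩
      i * i * (j * j) * (y₃ * y₃ + 2ℚ * (y₁ * y₃) + y₁ * y₁)             ≡⟨ cong₂ (λ a b → i * i * (j * j) * (a + 2ℚ * (y₁ * y₃) + b)) y₃²≡ y₁²≡ ⟩
      i * i * (j * j) * (x₁³ * E + 2ℚ * (y₁ * y₃) + x₁³ * F)             ≡⟨ cong (λ z → i * i * (j * j) * (x₁³ * E + 2ℚ * z + x₁³ * F)) y₁y₃≡ ⟩
      i * i * (j * j) * (x₁³ * E + 2ℚ * (x₁³ * w) + x₁³ * F)             ≡⟨ regroup i j x₁ E F w ⟩
      i * x₁ * (i * x₁) * (x₁ * (j * j * (E + 2ℚ * w + F)))              ≡⟨ cong (λ z → z * z * (x₁ * (j * j * (E + 2ℚ * w + F)))) ix₁≡1 ⟩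
      1ℚ * (x₁ * (j * j * (E + 2ℚ * w + F)))                             ≡⟨ *-identityˡ _ ⟩
      x₁ * (j * j * (E + 2ℚ * w + F))                                    ∎
      where
      expand : ∀ i j y z → i * j * (z + y) * (i * j * (z + y)) ≡ i * i * (j * j) * (z * z + 2ℚ * (y * z) + y * y)
      expand = solve-∀ ring
      regroup : ∀ i j x E F w → i * i * (j * j) * (x * x * x * E + 2ℚ * (x * x * x * w) + x * x * x * F)
                            ≡ i * x * (i * x) * (x * (j * j * (E + 2ℚ * w + F)))
      regroup = solve-∀ ring

    -- An odd square is 1 modulo 4; the remainder comes from squaring j = 2σj - 1.
    j²≡ : j * j ≡ 1ℚ + 2ℚ * (2ℚ * (σ * σ * j * j - σ * j))
    j²≡ = begin
      j * j                                                        ≡⟨ split j σ ⟩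
      j * (1ℚ + 2ℚ * (σ - 1ℚ)) * (j * (1ℚ + 2ℚ * (σ - 1ℚ)))
        + (2ℚ * (2ℚ * (σ * j * j - σ * σ * j * j)))                ≡⟨ cong (λ z → z * z + 2ℚ * (2ℚ * (σ * j * j - σ * σ * j * j))) (proj₂ unit) ⟩
      1ℚ + 2ℚ * (2ℚ * (σ * j * j - σ * σ * j * j))                 ≡⟨ regroup j σ ⟩
      1ℚ + 2ℚ * (2ℚ * (σ * σ * j * j - σ * j * (j * (1ℚ + 2ℚ * (σ - 1ℚ)))))
                                                                   ≡⟨ cong (λ z → 1ℚ + 2ℚ * (2ℚ * (σ * σ * j * j - σ * j * z))) (proj₂ unit) ⟩
      1ℚ + 2ℚ * (2ℚ * (σ * σ * j * j - σ * j * 1ℚ))                ≡⟨ cong (λ z → 1ℚ + 2ℚ * (2ℚ * (σ * σ * j * j - z))) (*-identityʳ (σ * j)) ⟩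
      1ℚ + 2ℚ * (2ℚ * (σ * σ * j * j - σ * j))                     ∎
      where
      split : ∀ j σ → j * j ≡ j * (1ℚ + 2ℚ * (σ - 1ℚ)) * (j * (1ℚ + 2ℚ * (σ - 1ℚ)))
                            + (2ℚ * (2ℚ * (σ * j * j - σ * σ * j * j)))
      split = solve-∀ ring
      regroup : ∀ j σ → 1ℚ + 2ℚ * (2ℚ * (σ * j * j - σ * σ * j * j))
                      ≡ 1ℚ + 2ℚ * (2ℚ * (σ * σ * j * j - σ * j * (j * (1ℚ + 2ℚ * (σ - 1ℚ)))))
      regroup = solve-∀ ring

    x′≡ : l * l - x₁ - x₃ ≡ 2ℚ * ρ * x₁
    x′≡ = begin
      l * l - x₁ - x₃                                                  ≡⟨ cong₂ (λ a b → a - x₁ - b) l²≡ x₃≡ ⟩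
      x₁ * (j * j * (E + 2ℚ * w + F)) - x₁ - 2ℚ * σ * x₁               ≡⟨ collect x₁ j σ α β w ⟩
      x₁ * (j * j + 2ℚ * (κ * j * j - σ) - 1ℚ)                         ≡⟨ cong (λ z → x₁ * (z + 2ℚ * (κ * j * j - σ) - 1ℚ)) j²≡ ⟩
      x₁ * (1ℚ + 2ℚ * (2ℚ * (σ * σ * j * j - σ * j)) + 2ℚ * (κ * j * j - σ) - 1ℚ) ≡⟨ finish x₁ j σ κ ⟩
      2ℚ * ρ * x₁                                                      ∎
      where
      collect : ∀ x j σ α β w →
        x * (j * j * (2ℚ * σ * (2ℚ * σ) * (2ℚ * σ) + 2ℚ * α * (2ℚ * σ) + 2ℚ * β + 2ℚ * w
                      + (1ℚ * 1ℚ * 1ℚ + 2ℚ * α * 1ℚ + 2ℚ * β))) - x - 2ℚ * σ * x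
        ≡ x * (j * j + 2ℚ * ((2ℚ * (2ℚ * (σ * σ * σ)) + 2ℚ * (α * σ) + β + w + α + β) * j * j - σ) - 1ℚ)
      collect = solve-∀ ring
      finish : ∀ x j σ κ → x * (1ℚ + 2ℚ * (2ℚ * (σ * σ * j * j - σ * j)) + 2ℚ * (κ * j * j - σ) - 1ℚ)
                         ≡ 2ℚ * (2ℚ * (σ * σ * j * j - σ * j) + κ * j * j - σ) * x
      finish = solve-∀ ring

  -- A direct computation is awkward: when x/x₁ is a unit, the abscissas of P and R agree modulo 2
  -- and the chord slope is indeterminate there. A singular P + R would instead make R = -P + (P +
  -- R) singular.
  regular-add : ∀ {R} → Regular R → On A B R → Regular (add A P R)
  regular-add {R} regular on with regular⊎singular (add A P R)
  ... | inj₁ regular′ = regular′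
  ... | inj₂ singular = ⊥-elim (regular∧singular⇒⊥ regular
    (subst Singular (add-neg-cancel on₁ y₁≢0 on) (singular-sub singular (on-add on₁ on))))

  -- P = -2R is impossible since doubling a regular point divides x by 4 up to odd factors.
  add≢neg : ∀ {R} → Regular R → On A B R → add A P R ≢ neg R
  add≢neg {aff x y} (aff ζ ζ-int x₁≡) on eq with add A P (aff x y) | add-sum on₁ on
  ... | _ | vertical _ _ = contradiction eq λ ()
  ... | _ | sloped l (slope chord tangent) _ = ½-not-integral θ-int (begin
      1ℚ                                                      ≡⟨ split a ⟩
      (3ℚ + 2ℚ * a) * (3ℚ + 2ℚ * a) - 2ℚ * (2ℚ * (2ℚ + 3ℚ * a + a * a))
                                                              ≡⟨ cong (_- 2ℚ * (2ℚ * (2ℚ + 3ℚ * a + a * a))) mod-x⁴ ⟩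
      2ℚ * 2ℚ * ((ζ + 2ℚ) * (1ℚ + 2ℚ * η)) - 2ℚ * (2ℚ * (2ℚ + 3ℚ * a + a * a))
                                                              ≡⟨ halve a ζ η ⟩
      2ℚ * θ                                                  ∎)
    where
    a η θ x⁴ : ℚ
    a = α * ζ * ζ
    η = α * ζ * ζ + β * ζ * ζ * ζ
    θ = 2ℚ * ((ζ + 2ℚ) * (1ℚ + 2ℚ * η)) - 2ℚ * (2ℚ + 3ℚ * a + a * a)
    x⁴ = x * x * (x * x)

    a-int : Integral a
    a-int = integral-* (integral-* α-int ζ-int) ζ-int

    θ-int : Integral θ
    θ-int = integral--
      (∙2 (integral-* (integral-+ ζ-int integral-2) (integral-+ integral-1 (∙2 (cubic-int ζ-int)))))
      (∙2 (integral-+ (integral-+ integral-2 (integral-* (integral-+ integral-2 integral-1) a-int)) (integral-* a-int a-int)))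

    x≢0 = regular-x≢0 ζ x₁≡

    l²≡ : l * l ≡ (ζ + 2ℚ) * x
    l²≡ = begin
      l * l                          ≡⟨ split l x₁ x ⟩
      l * l - x₁ - x + (x₁ + x)      ≡⟨ cong₂ (λ u v → u + (v + x)) (proj₁ (aff-injective eq)) x₁≡ ⟩
      x + (ζ * x + x)                ≡⟨ collect ζ x ⟩
      (ζ + 2ℚ) * x                   ∎
      where
      split : ∀ l x₁ x → l * l ≡ l * l - x₁ - x + (x₁ + x)
      split = solve-∀ ring
      collect : ∀ ζ x → x + (ζ * x + x) ≡ (ζ + 2ℚ) * x
      collect = solve-∀ ring

    -- On the line, the cubic minus the square of the ordinate has roots x₁, x and x₃, so its
    -- derivative at x is 3x² + A - 2ly = (x - x₁)(x - x₃). By `eq` x₃ = x, so the line is tangent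
    -- at R.
    doubled : 3ℚ * x * x + A ≡ 2ℚ * (l * y)
    doubled = begin
      3ℚ * x * x + A
        ≡⟨ cong (λ z → 3ℚ * x * x + z) tangent ⟩
      3ℚ * x * x + (l * (y₁ + y) - x₁ * x₁ - x₁ * x - x * x)
        ≡⟨ cong (λ z → 3ℚ * x * x + (l * (y₁ + z) - x₁ * x₁ - x₁ * x - x * x)) chord ⟩
      3ℚ * x * x + (l * (y₁ + (y₁ + l * (x - x₁))) - x₁ * x₁ - x₁ * x - x * x)
        ≡⟨ identity l x₁ y₁ x ⟩
      2ℚ * (l * (y₁ + l * (x - x₁))) - (x - x₁) * (l * l - x₁ - x - x)
        ≡⟨ cong₂ (λ u v → 2ℚ * (l * u) - (x - x₁) * v) (sym chord) (x≡y⇒x-y≡0 (proj₁ (aff-injective eq))) ⟩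
      2ℚ * (l * y) - (x - x₁) * 0ℚ
        ≡⟨ drop (2ℚ * (l * y)) (x - x₁) ⟩
      2ℚ * (l * y) ∎
      where
      identity : ∀ l x₁ y₁ x → 3ℚ * x * x + (l * (y₁ + (y₁ + l * (x - x₁))) - x₁ * x₁ - x₁ * x - x * x)
                             ≡ 2ℚ * (l * (y₁ + l * (x - x₁))) - (x - x₁) * (l * l - x₁ - x - x)
      identity = solve-∀ ring
      drop : ∀ u v → u - v * 0ℚ ≡ u
      drop = solve-∀ ring

    3x²+A≡ : 3ℚ * x * x + A ≡ x * x * (3ℚ + 2ℚ * a)
    3x²+A≡ = trans (cong (λ z → 3ℚ * x * x + z) (trans A≡ (cong (λ z → 2ℚ * α * (z * z)) x₁≡))) (factor x α ζ)
      where
      factor : ∀ x α ζ → 3ℚ * x * x + 2ℚ * α * (ζ * x * (ζ * x)) ≡ x * x * (3ℚ + 2ℚ * (α * ζ * ζ))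
      factor = solve-∀ ring

    -- Square the tangency relation and insert l² = (ζ + 2)x and y² = x³(1 + 2η). After division by
    -- x⁴ an odd square equals a multiple of 4.
    mod-x⁴ : (3ℚ + 2ℚ * a) * (3ℚ + 2ℚ * a) ≡ 2ℚ * 2ℚ * ((ζ + 2ℚ) * (1ℚ + 2ℚ * η))
    mod-x⁴ = *-cancelˡ x⁴ (*-≢0 (*-≢0 x≢0 x≢0) (*-≢0 x≢0 x≢0)) (begin
      x⁴ * ((3ℚ + 2ℚ * a) * (3ℚ + 2ℚ * a))                    ≡⟨ pair x (3ℚ + 2ℚ * a) ⟩
      x * x * (3ℚ + 2ℚ * a) * (x * x * (3ℚ + 2ℚ * a))         ≡⟨ cong (λ z → z * z) (trans (sym 3x²+A≡) doubled) ⟩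
      2ℚ * (l * y) * (2ℚ * (l * y))                           ≡⟨ separate l y ⟩
      2ℚ * 2ℚ * (l * l * (y * y))                             ≡⟨ cong₂ (λ u v → 2ℚ * 2ℚ * (u * v)) l²≡ (regular-curve ζ x₁≡ on) ⟩
      2ℚ * 2ℚ * ((ζ + 2ℚ) * x * (x * x * x * (1ℚ + 2ℚ * η)))  ≡⟨ regroup x (ζ + 2ℚ) (1ℚ + 2ℚ * η) ⟩
      x⁴ * (2ℚ * 2ℚ * ((ζ + 2ℚ) * (1ℚ + 2ℚ * η)))             ∎)
      where
      pair : ∀ x u → x * x * (x * x) * (u * u) ≡ x * x * u * (x * x * u)
      pair = solve-∀ ring
      separate : ∀ l y → 2ℚ * (l * y) * (2ℚ * (l * y)) ≡ 2ℚ * 2ℚ * (l * l * (y * y))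
      separate = solve-∀ ring
      regroup : ∀ x u v → 2ℚ * 2ℚ * (u * x * (x * x * x * v)) ≡ x * x * (x * x) * (2ℚ * 2ℚ * (u * v))
      regroup = solve-∀ ring

    split : ∀ a → 1ℚ ≡ (3ℚ + 2ℚ * a) * (3ℚ + 2ℚ * a) - 2ℚ * (2ℚ * (2ℚ + 3ℚ * a + a * a))
    split = solve-∀ ring
    halve : ∀ a ζ η → 2ℚ * 2ℚ * ((ζ + 2ℚ) * (1ℚ + 2ℚ * η)) - 2ℚ * (2ℚ * (2ℚ + 3ℚ * a + a * a))
                    ≡ 2ℚ * (2ℚ * ((ζ + 2ℚ) * (1ℚ + 2ℚ * η)) - 2ℚ * (2ℚ + 3ℚ * a + a * a))
    halve = solve-∀ ring

  -- Descent on the order of the point.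

  on-mul : ∀ n → On A B (mul A n P)
  on-mul zero    = O
  on-mul (suc n) = on-add on₁ (on-mul n)

  regular-mul : ∀ n → Regular (mul A n P)
  regular-mul zero    = O
  regular-mul (suc n) = regular-add (regular-mul n) (on-mul n)

  -- Induction on k moves one copy of P at a time across the equation, each time by
  -- `add-neg-cancel`.
  mul-reflect : ∀ k m → mul A (m ℕ.+ k) P ≡ O → mul A m P ≡ neg (mul A k P)
  mul-reflect zero    m eq = subst (λ n → mul A n P ≡ O) (ℕP.+-identityʳ m) eq
  mul-reflect (suc k) m eq = begin
    mul A m P                                  ≡⟨ add-neg-cancel on₁ y₁≢0 (on-mul m) ⟨
    add A (neg P) (add A P (mul A m P))        ≡⟨ cong (add A (neg P)) (mul-reflect k (suc m) (subst (λ n → mul A n P ≡ O) (ℕP.+-suc m k) eq)) ⟩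
    add A (neg P) (neg (mul A k P))            ≡⟨ neg-add on₁ (on-mul k) ⟩
    neg (add A P (mul A k P))                  ∎

  self-opposite⇒O : ∀ {R} → Regular R → On A B R → R ≡ neg R → R ≡ O
  self-opposite⇒O {O}       _       _  _  = refl
  self-opposite⇒O {aff x y} regular on eq = contradiction y≡0 (regular-y≢0 regular on)
    where
    y≡0 : y ≡ 0ℚ
    y≡0 = x+x≡0⇒x≡0 (trans (cong (λ z → y + z) (proj₂ (aff-injective eq))) (+-inverseʳ y))

  halve : ∀ n → ∃ λ m → n ≡ m ℕ.+ m ⊎ n ≡ suc (m ℕ.+ m)
  halve zero    = 0 , inj₁ refl
  halve (suc n) with halve n
  ... | m , inj₁ refl = m , inj₂ refl
  ... | m , inj₂ refl = suc m , inj₁ (cong suc (sym (ℕP.+-suc m m)))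

  mul≡O⇒0 : ∀ n → mul A n P ≡ O → n ≡ 0
  mul≡O⇒0 = <-rec (λ n → mul A n P ≡ O → n ≡ 0) step
    where
    step : ∀ n → (∀ {m} → m ℕ.< n → mul A m P ≡ O → m ≡ 0) → mul A n P ≡ O → n ≡ 0
    step n rec eq with halve n
    ... | zero  , inj₁ refl = refl
    ... | suc m , inj₁ refl = contradiction
      (rec (ℕP.m<m+n (suc m) (s≤s z≤n))
        (self-opposite⇒O (regular-mul (suc m)) (on-mul (suc m)) (mul-reflect (suc m) (suc m) eq))) λ ()
    ... | m     , inj₂ refl = contradiction (mul-reflect m (suc m) eq) (add≢neg (regular-mul m) (on-mul m))

  infinite-order : ∀ n → mul A (suc n) P ≢ O
  infinite-order n eq = contradiction (mul≡O⇒0 (suc n) eq) λ ()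

-- The curves Y² = X³ - 3X + (s² - 2)

B[_] : ℚ → ℚ
B[ s ] = s * s - 2ℚ

-- With z = 1/(2x) the hypotheses of infinite-order on A/x² and B/x³ become integrality statements.
record Witness (s : ℚ) : Set where
  field
    {x y} : ℚ
    z      : ℚ
    on     : On (- 3ℚ) B[ s ] (aff x y)
    2zx≡1  : 2ℚ * z * x ≡ 1ℚ
    z-int  : Integral z
    B-int  : Integral (2ℚ * 2ℚ * B[ s ] * (z * z * z))

integral-/1 : ∀ n → Integral (n / 1)
integral-/1 n = subst Integral (sym (/1≡ι n)) (integral-ι n)

-- P and 2P: the tangent at P is horizontal, because 3x² - 3 vanishes at x = -1.
P₁ P₂ : ℚ → Pt
P₁ s = aff (- 1ℚ) s
P₂ s = aff 2ℚ (- s)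

on-P₁ : ∀ s → On (- 3ℚ) B[ s ] (P₁ s)
on-P₁ s = aff (identity s)
  where
  identity : ∀ s → s * s ≡ - 1ℚ * - 1ℚ * - 1ℚ + - 3ℚ * - 1ℚ + (s * s - 2ℚ)
  identity = solve-∀ ring

on-P₂ : ∀ s → On (- 3ℚ) B[ s ] (P₂ s)
on-P₂ s = aff (identity s)
  where
  identity : ∀ s → - s * - s ≡ 2ℚ * 2ℚ * 2ℚ + - 3ℚ * 2ℚ + (s * s - 2ℚ)
  identity = solve-∀ ring

-- Slope of the chord through (-1, s) and (2, -s).
l₃ : ℚ → ℚ
l₃ s = - (+ 2 / 3) * s

P₃ : ℚ → Pt
P₃ s = third (l₃ s) (- 1ℚ) s 2ℚ

on-P₃ : ∀ s → On (- 3ℚ) B[ s ] (P₃ s)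
on-P₃ s = third-onCurve {x₂ = 2ℚ} {l = l₃ s} (on-P₁ s) (slope {y₂ = - s} (chord s) (tangent s))
  where
  chord : ∀ s → - s ≡ s + - (+ 2 / 3) * s * (2ℚ - - 1ℚ)
  chord = solve-∀ ring
  tangent : ∀ s → - 3ℚ ≡ - (+ 2 / 3) * s * (s + - s) - - 1ℚ * - 1ℚ - - 1ℚ * 2ℚ - 2ℚ * 2ℚ
  tangent = solve-∀ ring

-- The point 4P.
integral-witness : ∀ {s} → s ≢ 0ℚ → Integral s → Witness s
integral-witness {s} s≢0 s-int = record
  { z = z
  ; on = third-onCurve (on-P₂ s) (tangent-slope {l = l} tangent)
  ; 2zx≡1 = begin
      2ℚ * z * (l * l - 2ℚ - 2ℚ)                                         ≡⟨ clear s t e ⟩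
      e * ((+ 81 / 1) * (t * s * (t * s)) - (+ 16 / 1) * (s * s))        ≡⟨ cong (λ u → e * ((+ 81 / 1) * (u * u) - (+ 16 / 1) * (s * s))) ts≡1 ⟩
      e * ((+ 81 / 1) * (1ℚ * 1ℚ) - (+ 16 / 1) * (s * s))                ≡⟨ odd-form e s ⟩
      e * (1ℚ + 2ℚ * n)                                                  ≡⟨ proj₂ e-unit ⟩
      1ℚ                                                                 ∎
  ; z-int = z-int
  ; B-int = integral-* (integral-* (integral-* integral-2 integral-2) (integral-- (integral-* s-int s-int) integral-2))
                       (integral-* (integral-* z-int z-int) z-int)
  }
  where
  open ≡-Reasoning
  -- The abscissa is (81 - 16s²)/(4s²), and 81 - 16s² = 1 + 2n.
  n = (+ 40 / 1) - (+ 8 / 1) * (s * s)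
  n-int : Integral n
  n-int = integral-- (integral-/1 (+ 40)) (integral-* (integral-/1 (+ 8)) (integral-* s-int s-int))
  e-unit = inverse (odd-≢0 n-int)
  e = proj₁ e-unit
  t = proj₁ (inverse s≢0)
  ts≡1 : t * s ≡ 1ℚ
  ts≡1 = proj₂ (inverse s≢0)
  z = 2ℚ * (s * s) * e
  z-int : Integral z
  z-int = integral-* (integral-* integral-2 (integral-* s-int s-int)) (odd-unit n-int (proj₂ e-unit))
  -- Tangent slope (3·2² - 3)/(-2s) at (2, -s), with t = 1/s.
  l = - (+ 9 / 2) * t
  tangent : l * (- s + - s) ≡ 3ℚ * 2ℚ * 2ℚ + - 3ℚ
  tangent = trans (collect s t) (cong (λ u → (+ 9 / 1) * u) ts≡1)
    where
    collect : ∀ s t → - (+ 9 / 2) * t * (- s + - s) ≡ (+ 9 / 1) * (t * s)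
    collect = solve-∀ ring
  clear : ∀ s t e → 2ℚ * (2ℚ * (s * s) * e) * (- (+ 9 / 2) * t * (- (+ 9 / 2) * t) - 2ℚ - 2ℚ)
                  ≡ e * ((+ 81 / 1) * (t * s * (t * s)) - (+ 16 / 1) * (s * s))
  clear = solve-∀ ring
  odd-form : ∀ e s → e * ((+ 81 / 1) * (1ℚ * 1ℚ) - (+ 16 / 1) * (s * s))
                   ≡ e * (1ℚ + 2ℚ * ((+ 40 / 1) - (+ 8 / 1) * (s * s)))
  odd-form = solve-∀ ring

-- The point 3P.
quarter-witness : ∀ {s h} → Integral h → 2ℚ * (2ℚ * h) * s ≡ 1ℚ → Witness s
quarter-witness {s} {h} h-int 4hs≡1 = record
  { z = z
  ; on = on-P₃ s
  ; 2zx≡1 = begin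
      2ℚ * z * (l₃ s * l₃ s - - 1ℚ - 2ℚ)                                  ≡⟨ clear s h e ⟩
      e * (2ℚ * (2ℚ * h) * s * (2ℚ * (2ℚ * h) * s) - (+ 36 / 1) * (h * h)) ≡⟨ cong (λ u → e * (u * u - (+ 36 / 1) * (h * h))) 4hs≡1 ⟩
      e * (1ℚ * 1ℚ - (+ 36 / 1) * (h * h))                                ≡⟨ odd-form e h ⟩
      e * (1ℚ + 2ℚ * n)                                                   ≡⟨ proj₂ e-unit ⟩
      1ℚ                                                                  ∎
  ; z-int = integral-* (integral-* (integral-/1 (+ 18)) (integral-* h-int h-int)) e-int
  ; B-int = subst Integral (sym B≡) (integral-* (integral-* (integral-/1 (+ 1458))
      (integral-* (integral-* h-int h-int) (integral-* h-int h-int)))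
      (integral-* (integral-- (integral-* integral-1 integral-1) (integral-* (integral-/1 (+ 32)) (integral-* h-int h-int)))
                  (integral-* (integral-* e-int e-int) e-int)))
  }
  where
  open ≡-Reasoning
  -- With s = 1/(4h) the abscissa 4s²/9 - 1 becomes (1 - 36h²)/(36h²), and 1 - 36h² = 1 + 2n.
  n = - (+ 18 / 1) * (h * h)
  n-int : Integral n
  n-int = integral-* (integral-neg (integral-/1 (+ 18))) (integral-* h-int h-int)
  e-unit = inverse (odd-≢0 n-int)
  e = proj₁ e-unit
  e-int : Integral e
  e-int = odd-unit n-int (proj₂ e-unit)
  z = (+ 18 / 1) * (h * h) * e
  clear : ∀ s h e → 2ℚ * ((+ 18 / 1) * (h * h) * e) * (- (+ 2 / 3) * s * (- (+ 2 / 3) * s) - - 1ℚ - 2ℚ)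
                  ≡ e * (2ℚ * (2ℚ * h) * s * (2ℚ * (2ℚ * h) * s) - (+ 36 / 1) * (h * h))
  clear = solve-∀ ring
  odd-form : ∀ e h → e * (1ℚ * 1ℚ - (+ 36 / 1) * (h * h)) ≡ e * (1ℚ + 2ℚ * (- (+ 18 / 1) * (h * h)))
  odd-form = solve-∀ ring
  -- Here s² - 2 = (1 - 32h²)/(16h²) has a pole, which the factor h⁶ of z³ absorbs; 1458 = 4·18³/16.
  B≡ : 2ℚ * 2ℚ * B[ s ] * (z * z * z)
     ≡ (+ 1458 / 1) * (h * h * (h * h)) * ((1ℚ * 1ℚ - (+ 32 / 1) * (h * h)) * (e * e * e))
  B≡ = trans (collect s h e)
    (cong (λ u → (+ 1458 / 1) * (h * h * (h * h)) * ((u * u - (+ 32 / 1) * (h * h)) * (e * e * e))) 4hs≡1)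
    where
    collect : ∀ s h e → let z = (+ 18 / 1) * (h * h) * e in
      2ℚ * 2ℚ * (s * s - 2ℚ) * (z * z * z)
      ≡ (+ 1458 / 1) * (h * h * (h * h)) *
        ((2ℚ * (2ℚ * h) * s * (2ℚ * (2ℚ * h) * s) - (+ 32 / 1) * (h * h)) * (e * e * e))
    collect = solve-∀ ring

-- The point 5P = 2P + 3P.
half-witness : ∀ {k} → Integral k → Witness (½ + k)
half-witness {k} k-int = record
  { z = z
  ; on = third-onCurve (on-P₂ s) (chord-slope {l = l} (on-P₂ s) (on-P₃ s) dx≢0 chord)
  ; 2zx≡1 = begin
      2ℚ * z * (l * l - 2ℚ - (l₃ s * l₃ s - - 1ℚ - 2ℚ))                                ≡⟨ clear k d m ⟩
      m * (cubes * (dD * dD) - (+ 4 / 1) * (D * D) * ((+ 10 / 9) + (+ 4 / 9) * κ))     ≡⟨ cong (λ u → m * (cubes * (u * u) - (+ 4 / 1) * (D * D) * ((+ 10 / 9) + (+ 4 / 9) * κ))) (proj₂ d-unit) ⟩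
      m * (cubes * (1ℚ * 1ℚ) - (+ 4 / 1) * (D * D) * ((+ 10 / 9) + (+ 4 / 9) * κ))     ≡⟨ odd-form m k ⟩
      m * (1ℚ + 2ℚ * M)                                                                ≡⟨ proj₂ m-unit ⟩
      1ℚ                                                                               ∎
  ; z-int = z-int
  -- s² - 2 is not integral, but four times it is 4κ - 7.
  ; B-int = integral-* (subst Integral (sym (quadruple k))
      (integral-- (integral-* (integral-/1 (+ 4)) κ-int) (integral-/1 (+ 7))))
      (integral-* (integral-* z-int z-int) z-int)
  }
  where
  open ≡-Reasoning
  s = ½ + k
  -- (2s)² = 1 + 4κ. `D` = 2κ - 13 is the odd part of the abscissa difference (2/9)D between 3P and
  -- 2P. In `M`, the cubic terms in κ cancel: `cubes`, which is (2s)⁶/9, minus 4D²(10 + 4κ)/9 equals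
  -- 1 + 2M.
  κ = k + k * k
  D = 1ℚ + 2ℚ * (κ - (+ 7 / 1))
  M = (+ 40 / 1) * (κ * κ) - (+ 34 / 1) * κ - (+ 376 / 1)
  cubes = (+ 1 / 9) * ((1ℚ + (+ 4 / 1) * κ) * (1ℚ + (+ 4 / 1) * κ) * (1ℚ + (+ 4 / 1) * κ))

  κ-int : Integral κ
  κ-int = integral-+ k-int (integral-* k-int k-int)
  D-int : Integral (κ - (+ 7 / 1))
  D-int = integral-- κ-int (integral-/1 (+ 7))
  M-int : Integral M
  M-int = integral-- (integral-- (integral-* (integral-/1 (+ 40)) (integral-* κ-int κ-int))
    (integral-* (integral-/1 (+ 34)) κ-int)) (integral-/1 (+ 376))

  d-unit = inverse (odd-≢0 D-int)
  d = proj₁ d-unit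
  dD = d * D
  m-unit = inverse (odd-≢0 M-int)
  m = proj₁ m-unit

  z = 2ℚ * (D * D) * m
  z-int : Integral z
  z-int = integral-* (integral-* integral-2 (integral-* D-int′ D-int′)) (odd-unit M-int (proj₂ m-unit))
    where
    D-int′ : Integral D
    D-int′ = integral-+ integral-1 (integral-* integral-2 D-int)

  -- The ordinates of 3P and 2P differ by (8/27)s³; this is divided by (2/9)D.
  l = (+ 4 / 3) * (s * s * s) * d

  dx≡ : ∀ k → let s = ½ + k in
    - (+ 2 / 3) * s * (- (+ 2 / 3) * s) - - 1ℚ - 2ℚ - 2ℚ
    ≡ (+ 2 / 9) * (1ℚ + 2ℚ * (k + k * k - (+ 7 / 1)))
  dx≡ = solve-∀ ring

  dx≢0 : l₃ s * l₃ s - - 1ℚ - 2ℚ - 2ℚ ≢ 0ℚ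
  dx≢0 eq = *-≢0 {+ 2 / 9} (λ ()) (odd-≢0 D-int) (trans (sym (dx≡ k)) eq)

  chord : l * (l₃ s * l₃ s - - 1ℚ - 2ℚ - 2ℚ) ≡ thirdY (l₃ s) (- 1ℚ) s 2ℚ - - s
  chord = begin
    l * (l₃ s * l₃ s - - 1ℚ - 2ℚ - 2ℚ)     ≡⟨ cong (l *_) (dx≡ k) ⟩
    l * ((+ 2 / 9) * D)                    ≡⟨ collect s d D ⟩
    (+ 8 / 27) * (s * s * s) * (d * D)     ≡⟨ cong ((+ 8 / 27) * (s * s * s) *_) (proj₂ d-unit) ⟩
    (+ 8 / 27) * (s * s * s) * 1ℚ          ≡⟨ rise s ⟩
    thirdY (l₃ s) (- 1ℚ) s 2ℚ - - s        ∎
    where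
    collect : ∀ s d D → (+ 4 / 3) * (s * s * s) * d * ((+ 2 / 9) * D) ≡ (+ 8 / 27) * (s * s * s) * (d * D)
    collect = solve-∀ ring
    rise : ∀ s → let l = - (+ 2 / 3) * s in
      (+ 8 / 27) * (s * s * s) * 1ℚ ≡ l * (- 1ℚ - (l * l - - 1ℚ - 2ℚ)) - s - - s
    rise = solve-∀ ring

  clear : ∀ k d m → let s = ½ + k
                        κ = k + k * k
                        D = 1ℚ + 2ℚ * (κ - (+ 7 / 1))
                        q = 1ℚ + (+ 4 / 1) * κ
                        l = (+ 4 / 3) * (s * s * s) * d
                        l₃ = - (+ 2 / 3) * s in
    2ℚ * (2ℚ * (D * D) * m) * (l * l - 2ℚ - (l₃ * l₃ - - 1ℚ - 2ℚ))
    ≡ m * ((+ 1 / 9) * (q * q * q) * (d * D * (d * D)) - (+ 4 / 1) * (D * D) * ((+ 10 / 9) + (+ 4 / 9) * κ))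
  clear = solve-∀ ring

  odd-form : ∀ m k → let κ = k + k * k
                         D = 1ℚ + 2ℚ * (κ - (+ 7 / 1))
                         q = 1ℚ + (+ 4 / 1) * κ in
    m * ((+ 1 / 9) * (q * q * q) * (1ℚ * 1ℚ) - (+ 4 / 1) * (D * D) * ((+ 10 / 9) + (+ 4 / 9) * κ))
    ≡ m * (1ℚ + 2ℚ * ((+ 40 / 1) * (κ * κ) - (+ 34 / 1) * κ - (+ 376 / 1)))
  odd-form = solve-∀ ring

  quadruple : ∀ k → 2ℚ * 2ℚ * ((½ + k) * (½ + k) - 2ℚ) ≡ (+ 4 / 1) * (k + k * k) - (+ 7 / 1)
  quadruple = solve-∀ ring

-- The class of s separates v(s) ≥ 0 from a pole; then the class of g = 1/(2s) separates v(s) = -1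
-- from v(s) ≤ -2. An integral g has no pole.
witness : ∀ s → s ≢ 0ℚ → Witness s
witness s s≢0 with class₂ s
... | even r r-int refl = integral-witness s≢0 (integral-* integral-2 r-int)
... | odd  r r-int refl = integral-witness s≢0 (integral-+ integral-1 (integral-* integral-2 r-int))
... | pole g g-int 2gs≡1 with class₂ g
...   | even h h-int refl    = quarter-witness h-int 2gs≡1
...   | pole r r-int 2rg≡1   = contradiction (trans (sym 2rg≡1) (*-assoc 2ℚ r g)) (½-not-integral (integral-* r-int g-int))
...   | odd  h h-int refl    = subst Witness s≡ (half-witness k-int)
  where
  -- 2s is the inverse of the odd number 1 + 2h, hence integral, and s - ½ = -h(2s).
  k = - (h * (2ℚ * s))
  k-int : Integral k
  k-int = integral-neg (integral-* h-int (odd-unit h-int (trans (shuffle h s) 2gs≡1)))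
    where
    shuffle : ∀ h s → 2ℚ * s * (1ℚ + 2ℚ * h) ≡ 2ℚ * (1ℚ + 2ℚ * h) * s
    shuffle = solve-∀ ring
  s≡ : ½ + k ≡ s
  s≡ = trans (cong (λ u → ½ * u + k) (sym 2gs≡1)) (collect h s)
    where
    collect : ∀ h s → ½ * (2ℚ * (1ℚ + 2ℚ * h) * s) + - (h * (2ℚ * s)) ≡ s
    collect = solve-∀ ring

-- Rescaling to the given curve.

-- The map (x, y) ↦ (u²x, u³y) multiplies A by u⁴ and B by u⁶, so A/x² and B/x³, the only data
-- subject to integrality, are unchanged.
witness⇒positiveRank : ∀ {s} u → u ≢ 0ℚ → Witness s →
                       PositiveRank (- 3ℚ * (u * u * (u * u))) (B[ s ] * (u * u * u * (u * u * u)))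
witness⇒positiveRank {s} u u≢0 record { x = x; y = y; z = z; on = aff on; 2zx≡1 = 2zx≡1; z-int = z-int; B-int = B-int } =
  u * u * x , u * u * u * y , on-scaled ,
  infinite-order α-int B-int (*-≢0 (*-≢0 u≢0 u≢0) x≢0) A≡ B≡ (aff on-scaled)
  where
  open ≡-Reasoning
  -- -3/x² = -12z² = 2α, as 1/x = 2z.
  α = - (+ 6 / 1) * (z * z)
  α-int : Integral α
  α-int = integral-* (integral-neg (integral-/1 (+ 6))) (integral-* z-int z-int)

  x≢0 : x ≢ 0ℚ
  x≢0 refl = contradiction (trans (sym 2zx≡1) (*-zeroʳ (2ℚ * z))) λ ()

  A≡ : - 3ℚ * (u * u * (u * u)) ≡ 2ℚ * α * (u * u * x * (u * u * x))
  A≡ = sym (trans (collect u x z) (trans (cong (λ w → - 3ℚ * (u * u * (u * u)) * (w * w)) 2zx≡1) (*-identityʳ _)))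
    where
    collect : ∀ u x z → 2ℚ * (- (+ 6 / 1) * (z * z)) * (u * u * x * (u * u * x))
                      ≡ - 3ℚ * (u * u * (u * u)) * (2ℚ * z * x * (2ℚ * z * x))
    collect = solve-∀ ring

  B≡ : B[ s ] * (u * u * u * (u * u * u))
     ≡ 2ℚ * (2ℚ * 2ℚ * B[ s ] * (z * z * z)) * (u * u * x * (u * u * x) * (u * u * x))
  B≡ = sym (trans (collect B[ s ] u x z)
    (trans (cong (λ w → B[ s ] * (u * u * u * (u * u * u)) * (w * w * w)) 2zx≡1) (*-identityʳ _)))
    where
    collect : ∀ b u x z → 2ℚ * (2ℚ * 2ℚ * b * (z * z * z)) * (u * u * x * (u * u * x) * (u * u * x))
                        ≡ b * (u * u * u * (u * u * u)) * (2ℚ * z * x * (2ℚ * z * x) * (2ℚ * z * x))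
    collect = solve-∀ ring

  on-scaled : OnCurve (- 3ℚ * (u * u * (u * u))) (B[ s ] * (u * u * u * (u * u * u))) (u * u * x) (u * u * u * y)
  on-scaled = begin
    u * u * u * y * (u * u * u * y)                          ≡⟨ square u y ⟩
    u * u * u * (u * u * u) * (y * y)                        ≡⟨ cong (u * u * u * (u * u * u) *_) on ⟩
    u * u * u * (u * u * u) * (x * x * x + - 3ℚ * x + B[ s ]) ≡⟨ distribute u x B[ s ] ⟩
    u * u * x * (u * u * x) * (u * u * x) + - 3ℚ * (u * u * (u * u)) * (u * u * x) + B[ s ] * (u * u * u * (u * u * u)) ∎
    where
    square : ∀ u y → u * u * u * y * (u * u * u * y) ≡ u * u * u * (u * u * u) * (y * y)
    square = solve-∀ ring
    distribute : ∀ u x b → u * u * u * (u * u * u) * (x * x * x + - 3ℚ * x + b)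
      ≡ u * u * x * (u * u * x) * (u * u * x) + - 3ℚ * (u * u * (u * u)) * (u * u * x) + b * (u * u * u * (u * u * u))
    distribute = solve-∀ ring

theorem2p4 : (a b c : ℚ) → a * b * c ≢ 0ℚ → 2ℚ * a * c - b * b ≢ 0ℚ → (2ℚ * 2ℚ) * a * c - b * b ≢ 0ℚ
    → PositiveRank (A₂ a b c) (B₂ a b c)
theorem2p4 a b c abc≢0 2ac-b²≢0 _ =
  subst (λ A → PositiveRank A (B₂ a b c)) (A-scaled a c)
    (subst (PositiveRank (- 3ℚ * (u * u * (u * u)))) B-scaled (witness⇒positiveRank u u≢0 (witness s s≢0)))
  where
  open ≡-Reasoning
  u = a * c

  u≢0 : u ≢ 0ℚ
  u≢0 ac≡0 = abc≢0 (trans (shuffle a b c) (trans (cong (b *_) ac≡0) (*-zeroʳ b)))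
    where
    shuffle : ∀ a b c → a * b * c ≡ b * (a * c)
    shuffle = solve-∀ ring

  i = proj₁ (inverse u≢0)
  -- Completing the square in b²: 2a²c² - 4ab²c + b⁴ = (b² - 2ac)² - 2(ac)², which is u²(s² - 2).
  s = (b * b - 2ℚ * a * c) * i

  su≡ : s * u ≡ b * b - 2ℚ * a * c
  su≡ = trans (*-assoc (b * b - 2ℚ * a * c) i u) (trans (cong ((b * b - 2ℚ * a * c) *_) (proj₂ (inverse u≢0))) (*-identityʳ _))

  s≢0 : s ≢ 0ℚ
  s≢0 s≡0 = 2ac-b²≢0 (begin
    2ℚ * a * c - b * b           ≡⟨ flip a b c ⟩
    - (b * b - 2ℚ * a * c)       ≡⟨ cong -_ su≡ ⟨
    - (s * u)                    ≡⟨ cong (λ w → - (w * u)) s≡0 ⟩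
    - (0ℚ * u)                   ≡⟨ cong -_ (*-zeroˡ u) ⟩
    0ℚ                           ∎)
    where
    flip : ∀ a b c → 2ℚ * a * c - b * b ≡ - (b * b - 2ℚ * a * c)
    flip = solve-∀ ring

  A-scaled : ∀ a c → - 3ℚ * (a * c * (a * c) * (a * c * (a * c))) ≡ - (3ℚ * (a * a * a * a) * (c * c * c * c))
  A-scaled = solve-∀ ring

  B-scaled : B[ s ] * (u * u * u * (u * u * u)) ≡ B₂ a b c
  B-scaled = begin
    B[ s ] * (u * u * u * (u * u * u))                       ≡⟨ absorb s u ⟩
    u * u * (u * u) * (s * u * (s * u) - 2ℚ * (u * u))       ≡⟨ cong (λ w → u * u * (u * u) * (w * w - 2ℚ * (u * u))) su≡ ⟩
    u * u * (u * u) * ((b * b - 2ℚ * a * c) * (b * b - 2ℚ * a * c) - 2ℚ * (u * u)) ≡⟨ expand a b c ⟩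
    B₂ a b c                                                 ∎
    where
    absorb : ∀ s u → (s * s - 2ℚ) * (u * u * u * (u * u * u)) ≡ u * u * (u * u) * (s * u * (s * u) - 2ℚ * (u * u))
    absorb = solve-∀ ring
    expand : ∀ a b c → let u = a * c in
      u * u * (u * u) * ((b * b - 2ℚ * a * c) * (b * b - 2ℚ * a * c) - 2ℚ * (u * u))
      ≡ (a * a * a * a) * (c * c * c * c)
        * (2ℚ * (a * a) * (c * c) - (2ℚ + 2ℚ) * a * (b * b) * c + b * b * b * b)
    expand = solve-∀ ring
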